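{- Let $H$ be a constant-size connected graph that contains an edge $\{u,v\}$ such that every cycle of $H$ contains at least one of $u$ and $v$. Then $H$-freeness can be tested in $O(1/\epsilon)$ rounds in the CONGEST model (the constant hidden in the $O$-notation may depend on $H$, but not on $\epsilon$ or the network graph).
   Context: CONGEST model: the network is an undirected graph $G=(V,E)$ with $n=|V|$ nodes and $m=|E|$ edges, nodes have unique $O(\log n)$-bit identifiers and know $n$; computation is synchronous, and in each round every node may send $O(\log n)$ bits over each incident edge; nodes have private randomness. "Subgraph" means not-necessarily-induced subgraph. $G$ is $H$-free if it contains no subgraph isomorphic to $H$. $G$ is $\epsilon$-far from a property if at least $\epsilon|E|$ edges must be added to or removed from $E$ to obtain a graph with the property. Testing $H$-freeness with parameter $0<\epsilon\le 1$ (known to the algorithm): if $G$ is $H$-free then with probability at least $2/3$ all nodes accept; if $G$ is $\epsilon$-far from $H$-free then with probability at least $2/3$ some node rejects. -}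

module Defs where

open import Data.Bool using (Bool; true; false)
import Data.Bool as Bool
open import Data.Nat using (ℕ; zero; suc; _*_; _≤_; _<_)
open import Data.Nat.Logarithm using (⌈log₂_⌉)
open import Data.Integer using (+_)
open import Data.Rational as ℚ using (ℚ; 0ℚ; 1ℚ)
open import Data.Fin using (Fin)
import Data.Fin as Fin
open import Data.Fin.Properties using (all?; any?)
open import Data.List using (List; []; _∷_; [_]; _++_; length; filter; cartesianProduct; cartesianProductWith; allFin)
open import Data.List.Membership.Propositional using (_∈_)
open import Data.List.Relation.Unary.Linked using (Linked)
open import Data.List.Relation.Unary.Unique.Propositional using (Unique)
open import Data.Vec using (Vec; []; _∷_; lookup)
open import Data.Product using (Σ-syntax; ∃-syntax; _×_; _,_)
open import Data.Sum using (_⊎_)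
open import Function.Definitions using (Injective)
open import Relation.Binary.Construct.Closure.ReflexiveTransitive using (Star)
open import Relation.Binary.PropositionalEquality using (_≡_; trans)
open import Relation.Nullary using (¬_)
open import Relation.Nullary.Decidable using (¬?)
open import Relation.Unary using (Decidable)

record Graph (n : ℕ) : Set where
  field
    adj    : Fin n → Fin n → Bool
    symm   : ∀ i j → adj i j ≡ adj j i
    irrefl : ∀ i → adj i i ≡ false

  Adj : Fin n → Fin n → Set
  Adj i j = adj i j ≡ true

  Adj-sym : ∀ {i j} → Adj i j → Adj j i
  Adj-sym {i} {j} e = trans (symm j i) e

  Connected : Set
  Connected = ∀ i j → Star Adj i j

  -- The cycle x, x₁, …, xₗ, x is given by its l + 1 ≥ 3 distinct vertices
  -- x ∷ xs.
  IsCycle : Fin n → List (Fin n) → Set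
  IsCycle x xs = 2 ≤ length xs × Unique (x ∷ xs) × Linked Adj (x ∷ xs ++ [ x ])

open Graph public

EveryCycleMeets : ∀ {n} (G : Graph n) (u v : Fin n) → Set
EveryCycleMeets G u v =
  ∀ x xs → IsCycle G x xs → u ∈ x ∷ xs ⊎ v ∈ x ∷ xs

-- G has a (not necessarily induced) subgraph isomorphic to H.
Contains : ∀ {n h} → Graph n → Graph h → Set
Contains {n} {h} G H =
  Σ[ f ∈ (Fin h → Fin n) ]
    Injective _≡_ _≡_ f × (∀ i j → Adj H i j → Adj G (f i) (f j))

Free : ∀ {n h} → Graph h → Graph n → Set
Free H G = ¬ Contains G H

-- Each unordered pair of distinct vertices once, as (i , j) with i < j.
vertexPairs : ∀ n → List (Fin n × Fin n)
vertexPairs n =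
  filter (λ (i , j) → i Fin.<? j) (cartesianProduct (allFin n) (allFin n))

edgeCount : ∀ {n} → Graph n → ℕ
edgeCount {n} G =
  length (filter (λ (i , j) → adj G i j Bool.≟ true) (vertexPairs n))

-- The number of edges to be added or removed to turn G into G′.
editDistance : ∀ {n} → Graph n → Graph n → ℕ
editDistance {n} G G′ =
  length (filter (λ (i , j) → ¬? (adj G i j Bool.≟ adj G′ i j)) (vertexPairs n))

fromℕ : ℕ → ℚ
fromℕ k = (+ k) ℚ./ 1

IsFar : ∀ {n} → ℚ → (Graph n → Set) → Graph n → Set
IsFar ε P G =
  ∀ G′ → P G′ → ε ℚ.* fromℕ (edgeCount G) ℚ.≤ fromℕ (editDistance G G′)

Bits : ℕ → Set
Bits = Vec Bool

-- The CONGEST network: the edges at a vertex v are locally numbered by ports, in an arbitrary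
-- order; initially v knows its own identifier and its degree, but not the
-- identifiers of its neighbours.
record Network {n : ℕ} (G : Graph n) (idBits : ℕ) : Set where
  field
    ident           : Fin n → Bits idBits
    ident-injective : Injective _≡_ _≡_ ident
    deg             : Fin n → ℕ
    nbr             : ∀ v → Fin (deg v) → Fin n
    nbr-adj         : ∀ v p → Adj G v (nbr v p)
    nbr-injective   : ∀ v → Injective _≡_ _≡_ (nbr v)
    port            : ∀ v w → Adj G v w → Fin (deg v)
    nbr-port        : ∀ v w (e : Adj G v w) → nbr v (port v w e) ≡ w

  -- The port of the other endpoint for the edge at port p of v.
  backPort : ∀ v p → Fin (deg (nbr v p))
  backPort v p = port (nbr v p) v (Adj-sym G (nbr-adj v p))

-- The program run by every node; d is the degree of the node. A node may use
-- its private random bits in any round, as its state can retain them. In each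
-- round exactly msgBits bits cross each edge in each direction, so silence
-- and shorter messages have to be encoded.
record Algorithm (idBits msgBits : ℕ) : Set₁ where
  field
    rounds     : ℕ
    randomBits : ℕ
    State      : ℕ → Set
    init       : ∀ d → Bits idBits → Bits randomBits → State d
    send       : ∀ d → State d → Fin d → Bits msgBits
    receive    : ∀ d → State d → (Fin d → Bits msgBits) → State d
    accepts    : ∀ d → State d → Bool

module Execution {n idBits msgBits : ℕ} {G : Graph n}
                 (A : Algorithm idBits msgBits) (N : Network G idBits) where
  open Algorithm A
  open Network N

  Seeds : Set
  Seeds = Vec (Bits randomBits) n

  stateAfter : ℕ → Seeds → ∀ v → State (deg v)
  stateAfter zero    ω v = init (deg v) (ident v) (lookup ω v)
  stateAfter (suc t) ω v =
    receive (deg v) (stateAfter t ω v) λ p →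
      send (deg (nbr v p)) (stateAfter t ω (nbr v p)) (backPort v p)

  verdict : Seeds → Fin n → Bool
  verdict ω v = accepts (deg v) (stateAfter rounds ω v)

  AllAccept : Seeds → Set
  AllAccept ω = ∀ v → verdict ω v ≡ true

  SomeReject : Seeds → Set
  SomeReject ω = ∃[ v ] verdict ω v ≡ false

  AllAccept? : Decidable AllAccept
  AllAccept? ω = all? λ v → verdict ω v Bool.≟ true

  SomeReject? : Decidable SomeReject
  SomeReject? ω = any? λ v → verdict ω v Bool.≟ false

vectorsOver : ∀ {A : Set} → List A → ∀ n → List (Vec A n)
vectorsOver xs zero    = [ [] ]
vectorsOver xs (suc n) = cartesianProductWith _∷_ xs (vectorsOver xs n)

allBits : ∀ r → List (Bits r)
allBits = vectorsOver (false ∷ true ∷ [])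

-- For independent uniformly random bits, r at each of n nodes:
-- Pr[P] = #{ω | P ω} / #{ω} ≥ 2/3, with denominators cleared.
ProbAtLeast⅔ : ∀ {n r} {P : Vec (Bits r) n → Set} → Decidable P → Set
ProbAtLeast⅔ {n} {r} P? = 2 * length Ω ≤ 3 * length (filter P? Ω)
  where
  Ω : List (Vec (Bits r) n)
  Ω = vectorsOver (allBits r) n

-- Without edges, every graph would be ε-far from every property (even from
-- those it has), since 0 ≥ ε · 0; hence the condition 0 < edgeCount G.
IsFreenessTester : ∀ {h idBits msgBits} → Graph h → (n : ℕ) → ℚ →
                   Algorithm idBits msgBits → Set
IsFreenessTester {idBits = idBits} H n ε A =
  ∀ (G : Graph n) (N : Network G idBits) → let open Execution A N in
    (Free H G → ProbAtLeast⅔ AllAccept?) ×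
    (0 < edgeCount G → IsFar ε (Free H) G → ProbAtLeast⅔ SomeReject?)

-- Identifiers have a · ⌈log₂ n⌉ bits, where a is a constant of the model, and
-- messages c · ⌈log₂ n⌉ bits. The program depends on n and ε, which are known
-- to the nodes. The bound on the rounds is rounds ≤ C / ε.
FreenessTestableInO[1/ε] : ∀ {h} → Graph h → Set₁
FreenessTestableInO[1/ε] H =
  Σ[ C ∈ ℕ ] ∀ (a : ℕ) → Σ[ c ∈ ℕ ]
  Σ[ 𝒜 ∈ (∀ n → ℚ → Algorithm (a * ⌈log₂ n ⌉) (c * ⌈log₂ n ⌉)) ]
    ∀ n ε → 0ℚ ℚ.< ε → ε ℚ.≤ 1ℚ →
      fromℕ (Algorithm.rounds (𝒜 n ε)) ℚ.* ε ℚ.≤ fromℕ C ×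
      IsFreenessTester H n ε (𝒜 n ε)

{-# OPTIONS --safe #-}

-- Deleting every edge that is the image of uv in some copy of H makes G free
-- of H. If G is ε-far from H-freeness, a uniformly random arc of G is therefore
-- the image of (u , v) in a copy with probability Ω(ε). Each iteration samples
-- an arc as the one of largest random weight (found locally by flooding), lets
-- every vertex choose a random role in H, and discards repeatedly the vertices
-- that miss a neighbour in a role adjacent to theirs. The images of u and v are
-- unique, and H - {u , v} is a forest, so the roles that survive along it
-- can be assembled into a copy of H, adding each vertex of the forest when at
-- most one of its neighbours is already placed: a rejection is never wrong.
-- A sampled arc lying in a copy with the right roles is always detected, so
-- O(1/ε) independent iterations suffice.

module Submission where

open import Defs
open import Data.Bool using (Bool; true; false; not; _∧_; _∨_)
import Data.Bool as Bool
import Data.Bool.Properties as Bool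
open import Data.Empty using (⊥)
open import Data.Fin using (Fin; zero; suc; toℕ)
import Data.Fin as Fin
import Data.Fin.Properties as Fin
import Data.Integer as ℤ
import Data.Integer.Properties as ℤ
open import Data.List using (List; []; _∷_; [_]; _++_; map; length; filter; replicate; cartesianProduct; cartesianProductWith; allFin; tabulate)
import Data.List as List
import Data.List.Properties as List
open import Data.List.Membership.Propositional using (_∈_; _∉_; find; lose)
open import Data.List.Membership.Propositional.Properties using (∈-cartesianProductWith⁺; ∈-∃++; ∈-length; ∈-lookup; ∈-filter⁺; ∈-filter⁻; ∈-allFin)
import Data.List.Membership.DecPropositional as DecMembership
open import Data.List.Relation.Unary.All as All using (All; []; _∷_)
import Data.List.Relation.Unary.All.Properties as All
open import Data.List.Relation.Unary.AllPairs using ([]; _∷_)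
open import Data.List.Relation.Unary.Any as Any using (here; there)
import Data.List.Relation.Unary.Any.Properties as Any
open import Data.List.Relation.Unary.Linked using (Linked; [-]; _∷_)
open import Data.List.Relation.Unary.Unique.Propositional using (Unique)
open import Data.Nat using (ℕ; zero; suc; _+_; _*_; _∸_; _^_; _≤_; _<_; z≤n; s≤s; s≤s⁻¹; NonZero)
import Data.Nat as ℕ
open import Data.Nat.Coprimality using (Coprime)
open import Data.Nat.DivMod using (_/_; _%_; m≡m%n+[m/n]*n; m%n<n)
import Data.Nat.ListAction as ListAction
open import Data.Nat.Logarithm using (⌈log₂_⌉; ⌈log₂⌉-mono-≤; ⌈log₂2^n⌉≡n; ⌈log₂⌈n/2⌉⌉≡⌈log₂n⌉∸1)
open import Data.Nat.Properties
open import Data.Nat.Tactic.RingSolver using (solve-∀)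
open import Data.Product using (Σ-syntax; ∃-syntax; _×_; _,_; proj₁; proj₂)
import Data.Product.Properties as Product
open import Data.Rational as ℚ using (ℚ; mkℚ; 0ℚ; 1ℚ; ↥_; ↧ₙ_)
import Data.Rational.Properties as ℚ
import Data.Rational.Unnormalised as ℚᵘ
import Data.Rational.Unnormalised.Properties as ℚᵘ
open import Data.Sum using (_⊎_; inj₁; inj₂)
open import Data.Vec using (Vec; []; _∷_; lookup; take; drop)
import Data.Vec as Vec
import Data.Vec.Properties as Vec
open import Function using (_∘_; id; case_of_)
open import Function.Definitions using (Injective)
open import Relation.Binary.Construct.Closure.ReflexiveTransitive as Star using (Star)
open import Relation.Binary.Definitions using (DecidableEquality)
open import Relation.Binary.PropositionalEquality hiding ([_])
open import Relation.Nullary using (Dec; yes; no; ¬_; contradiction; does)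
open import Relation.Nullary.Decidable using (map′; ¬?; _×-dec_; _→-dec_; decidable-stable; dec-true)
open import Relation.Unary using (Decidable)
open import Algebra.Properties.CommutativeMonoid.Sum +-0-commutativeMonoid using (sum; sum-syntax; ∑-distrib-+; ∑-comm; sum-cong-≗)
open import Algebra.Properties.CommutativeMonoid.Sum *-1-commutativeMonoid using () renaming (sum to product; ∑-distrib-+ to product-*; sum-cong-≗ to product-cong)
open import Algebra.Properties.Semiring.Sum +-*-semiring using (*-distribˡ-sum; *-distribʳ-sum)

-- Messages of O(log n) bits shape the sampling. Weights have only 3⌈log₂ n⌉ bits, so ties occur,
-- and a draw counts as a success only if one arc is strictly heaviest in the whole network. These
-- events are disjoint for different arcs, so their probabilities add up. Each has probability at
-- least 1/(2M), where M ≤ 2|E| is the number of arcs, because at least 2M weights are available. A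
-- colour is h random bits, of which only the one-hot vectors are roles, so a copy draws its roles
-- with probability 2^(-h²). With at least ε|E| arcs in copies, an iteration succeeds with
-- probability at least ε / (4 · 2^(h²)), whence the constant `Q`. Running flooding or pruning to a
-- fixed point could take too many rounds. Flooding only has to cross a copy; elsewhere other arcs
-- may win, and vertices with different tags do not support each other. Pruning stops after a number
-- of rounds that depends on H alone: the rounds that a vertex has survived act as its level, and
-- assembling a copy spends levels step by step.

private
  variable
    A A′ : Set
    n : ℕ

-- Sums

⟦_⟧ : ∀ {P : Set} → Dec P → ℕ
⟦ yes _ ⟧ = 1
⟦ no  _ ⟧ = 0

⟦⟧-yes : ∀ {P : Set} (d : Dec P) → P → ⟦ d ⟧ ≡ 1
⟦⟧-yes (yes _) _ = refl
⟦⟧-yes (no ¬p) p = contradiction p ¬p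

⟦⟧-no : ∀ {P : Set} (d : Dec P) → ¬ P → ⟦ d ⟧ ≡ 0
⟦⟧-no (yes p) ¬p = contradiction p ¬p
⟦⟧-no (no _)  _  = refl

⟦⟧≤1 : ∀ {P : Set} (d : Dec P) → ⟦ d ⟧ ≤ 1
⟦⟧≤1 (yes _) = ≤-refl
⟦⟧≤1 (no _)  = z≤n

⟦⟧-positive : ∀ {P : Set} (d : Dec P) → 0 < ⟦ d ⟧ → P
⟦⟧-positive (yes p) _ = p

sum-mono-≤ : {f g : Fin n → ℕ} → (∀ i → f i ≤ g i) → sum f ≤ sum g
sum-mono-≤ {zero}  f≤g = z≤n
sum-mono-≤ {suc n} f≤g = +-mono-≤ (f≤g zero) (sum-mono-≤ (f≤g ∘ suc))

sum-const : ∀ n c → (∑[ i < n ] c) ≡ n * c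
sum-const zero    c = refl
sum-const (suc n) c = cong (c +_) (sum-const n c)

product-mono-≤ : {f g : Fin n → ℕ} → (∀ i → f i ≤ g i) → product f ≤ product g
product-mono-≤ {zero}  f≤g = ≤-refl
product-mono-≤ {suc n} f≤g = *-mono-≤ (f≤g zero) (product-mono-≤ (f≤g ∘ suc))

product-const : ∀ n c → product {n} (λ _ → c) ≡ c ^ n
product-const zero    c = refl
product-const (suc n) c = cong (c *_) (product-const n c)

product-^ : ∀ c (f : Fin n → ℕ) → product (λ i → c ^ f i) ≡ c ^ sum f
product-^ {zero}  c f = refl
product-^ {suc n} c f =
  trans (cong (c ^ f zero *_) (product-^ c (f ∘ suc)))
        (sym (^-distribˡ-+-* c (f zero) (sum (f ∘ suc))))

product-ones : (f : Fin n → ℕ) → (∀ i → f i ≡ 1) → product f ≡ 1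
product-ones {n} f f≡1 =
  trans (product-cong f≡1) (trans (product-const n 1) (^-zeroˡ n))

product-positive : (f : Fin n → ℕ) → 0 < product f → ∀ i → 0 < f i
product-positive f p zero with f zero
... | suc _ = s≤s z≤n
product-positive f p (suc i) =
  product-positive (f ∘ suc) (n≢0⇒n>0 λ eq →
    <⇒≢ p (sym (trans (cong (f zero *_) eq) (*-zeroʳ (f zero))))) i

product-pos : (f : Fin n → ℕ) → (∀ i → 0 < f i) → 0 < product f
product-pos {zero}  f p = s≤s z≤n
product-pos {suc n} f p = *-mono-≤ (p zero) (product-pos (f ∘ suc) (p ∘ suc))

product≤1 : (f : Fin n → ℕ) → (∀ i → f i ≤ 1) → product f ≤ 1
product≤1 {n} f f≤1 =
  ≤-trans (product-mono-≤ f≤1) (≤-reflexive (product-ones {n} (λ _ → 1) λ _ → refl))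

term≤product : (f : Fin n → ℕ) → (∀ i → 0 < f i) → ∀ i → f i ≤ product f
term≤product f pos zero =
  ≤-trans (≤-reflexive (sym (*-identityʳ _)))
          (*-monoʳ-≤ (f zero) (product-pos (f ∘ suc) (pos ∘ suc)))
term≤product f pos (suc i) =
  ≤-trans (term≤product (f ∘ suc) (pos ∘ suc) i)
          (≤-trans (≤-reflexive (sym (*-identityˡ _)))
                   (*-monoˡ-≤ (product (f ∘ suc)) (pos zero)))

term≤sum : (f : Fin n → ℕ) → ∀ i → f i ≤ sum f
term≤sum f zero    = m≤m+n _ _
term≤sum f (suc i) = ≤-trans (term≤sum (f ∘ suc) i) (m≤n+m _ _)

sum-positive : (f : Fin n → ℕ) → 0 < sum f → ∃[ i ] 0 < f i
sum-positive {suc n} f p with f zero in eq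
... | suc _ = zero , subst (0 <_) (sym eq) (s≤s z≤n)
... | zero  = let i , q = sum-positive (f ∘ suc) p in suc i , q

sum-zero : (f : Fin n → ℕ) → (∀ i → f i ≡ 0) → sum f ≡ 0
sum-zero {n} f f≡0 = trans (sum-cong-≗ f≡0) (trans (sum-const n 0) (*-zeroʳ n))

sum-unique : (f : Fin n → ℕ) → (∀ i → f i ≤ 1) →
             (∀ i j → 0 < f i → 0 < f j → i ≡ j) → sum f ≤ 1
sum-unique {zero}  f f≤1 uniq = z≤n
sum-unique {suc n} f f≤1 uniq with f zero in eq
... | zero  = sum-unique (f ∘ suc) (f≤1 ∘ suc) λ i j p q →
                Fin.suc-injective (uniq (suc i) (suc j) p q)
... | suc k = begin
    suc k + sum (f ∘ suc) ≡⟨ cong (suc k +_) (sum-zero (f ∘ suc) rest) ⟩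
    suc k + 0             ≡⟨ +-identityʳ (suc k) ⟩
    suc k                 ≡⟨ eq ⟨
    f zero                ≤⟨ f≤1 zero ⟩
    1                     ∎
  where
  open ≤-Reasoning
  rest : ∀ i → f (suc i) ≡ 0
  rest i with f (suc i) in eq′
  ... | zero  = refl
  ... | suc _ with () ← uniq zero (suc i) (subst (0 <_) (sym eq) (s≤s z≤n))
                                          (subst (0 <_) (sym eq′) (s≤s z≤n))

sum-indicator : (i : Fin n) → (∑[ j < n ] ⟦ i Fin.≟ j ⟧) ≡ 1
sum-indicator {n} i = ≤-antisym
  (sum-unique _ (λ j → ⟦⟧≤1 (i Fin.≟ j)) λ j k p q →
    trans (sym (⟦⟧-positive (i Fin.≟ j) p)) (⟦⟧-positive (i Fin.≟ k) q))
  (≤-trans (≤-reflexive (sym (⟦⟧-yes (i Fin.≟ i) refl)))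
           (term≤sum (λ j → ⟦ i Fin.≟ j ⟧) i))

-- Double counting of the pairs (p , j) with `g p ≡ j`: every p has one such j, and injectivity
-- leaves at most one p for each j, none for a j outside `P`.
sum-injection : ∀ {d} {P : Fin n → Set} (P? : Decidable P) (g : Fin d → Fin n) →
                (∀ {p q} → g p ≡ g q → p ≡ q) → (∀ p → P (g p)) →
                d ≤ ∑[ j < n ] ⟦ P? j ⟧
sum-injection {n} {d} {P} P? g inj Pg = begin
  d                                      ≡⟨ *-identityʳ d ⟨
  d * 1                                  ≡⟨ sum-const d 1 ⟨
  ∑[ p < d ] 1                           ≡⟨ sum-cong-≗ (λ p → sum-indicator (g p)) ⟨
  ∑[ p < d ] ∑[ j < n ] ⟦ g p Fin.≟ j ⟧  ≡⟨ ∑-comm (λ p j → ⟦ g p Fin.≟ j ⟧) ⟩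
  ∑[ j < n ] ∑[ p < d ] ⟦ g p Fin.≟ j ⟧  ≤⟨ sum-mono-≤ preimages ⟩
  ∑[ j < n ] ⟦ P? j ⟧                    ∎
  where
  open ≤-Reasoning
  preimages : ∀ j → (∑[ p < d ] ⟦ g p Fin.≟ j ⟧) ≤ ⟦ P? j ⟧
  preimages j with P? j
  ... | yes _ = sum-unique _ (λ p → ⟦⟧≤1 (g p Fin.≟ j)) λ p q a b →
                  inj (trans (⟦⟧-positive (g p Fin.≟ j) a) (sym (⟦⟧-positive (g q Fin.≟ j) b)))
  ... | no ¬p = ≤-reflexive (sum-zero _ λ p →
                  ⟦⟧-no (g p Fin.≟ j) λ eq → ¬p (subst P eq (Pg p)))

sum-toℕ-+ : ∀ m n (f : ℕ → ℕ) →
            (∑[ i < m + n ] f (toℕ i)) ≡ (∑[ i < m ] f (toℕ i)) + (∑[ i < n ] f (m + toℕ i))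
sum-toℕ-+ zero    n f = refl
sum-toℕ-+ (suc m) n f =
  trans (cong (f 0 +_) (sum-toℕ-+ m n (f ∘ suc))) (sym (+-assoc (f 0) _ _))

sum-below : ∀ {w} → w ≤ n → (∑[ i < n ] ⟦ toℕ i ℕ.<? w ⟧) ≡ w
sum-below {n} {zero}  w≤n = sum-zero {n} _ λ i → ⟦⟧-no (toℕ i ℕ.<? 0) λ ()
sum-below {suc n} {suc w} (s≤s w≤n) = cong suc (trans (sum-cong-≗ {n} step) (sum-below w≤n))
  where
  step : ∀ i → ⟦ suc (toℕ i) ℕ.<? suc w ⟧ ≡ ⟦ toℕ i ℕ.<? w ⟧
  step i with toℕ i ℕ.<? w
  ... | yes p = ⟦⟧-yes (suc (toℕ i) ℕ.<? suc w) (s≤s p)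
  ... | no ¬p = ⟦⟧-no (suc (toℕ i) ℕ.<? suc w) (¬p ∘ s≤s⁻¹)

sum-equal : ∀ {w} → w < n → (∑[ i < n ] ⟦ toℕ i ℕ.≟ w ⟧) ≡ 1
sum-equal {n} {w} w<n = trans (sum-cong-≗ {n} same) (sum-indicator (Fin.fromℕ< w<n))
  where
  same : ∀ i → ⟦ toℕ i ℕ.≟ w ⟧ ≡ ⟦ Fin.fromℕ< w<n Fin.≟ i ⟧
  same i with Fin.fromℕ< w<n Fin.≟ i
  ... | yes refl = ⟦⟧-yes (toℕ i ℕ.≟ w) (Fin.toℕ-fromℕ< w<n)
  ... | no ¬p    = ⟦⟧-no (toℕ i ℕ.≟ w) λ eq →
                     ¬p (Fin.toℕ-injective (trans (Fin.toℕ-fromℕ< w<n) (sym eq)))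

telescope : ∀ (F G : ℕ → ℕ) → (∀ j → F (suc j) ≤ F j + G j) →
            ∀ n → F n ≤ F 0 + (∑[ j < n ] G (toℕ j))
telescope F G step zero    = m≤m+n _ _
telescope F G step (suc n) = begin
  F (suc n)                                      ≤⟨ telescope (F ∘ suc) (G ∘ suc) (step ∘ suc) n ⟩
  F 1 + (∑[ j < n ] G (suc (toℕ j)))             ≤⟨ +-monoˡ-≤ _ (step 0) ⟩
  F 0 + G 0 + (∑[ j < n ] G (suc (toℕ j)))       ≡⟨ +-assoc (F 0) (G 0) _ ⟩
  F 0 + (G 0 + (∑[ j < n ] G (suc (toℕ j))))     ∎
  where open ≤-Reasoning

-- Sums over lists

∑ₗ : List A → (A → ℕ) → ℕ
∑ₗ xs f = ListAction.sum (map f xs)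

∑ₗ-cong : ∀ (xs : List A) {f g : A → ℕ} → (∀ x → f x ≡ g x) → ∑ₗ xs f ≡ ∑ₗ xs g
∑ₗ-cong xs eq = cong ListAction.sum (List.map-cong eq xs)

∑ₗ-mono-≤ : ∀ (xs : List A) {f g : A → ℕ} → (∀ x → f x ≤ g x) → ∑ₗ xs f ≤ ∑ₗ xs g
∑ₗ-mono-≤ []       f≤g = z≤n
∑ₗ-mono-≤ (x ∷ xs) f≤g = +-mono-≤ (f≤g x) (∑ₗ-mono-≤ xs f≤g)

∑ₗ-++ : ∀ (xs ys : List A) (f : A → ℕ) → ∑ₗ (xs ++ ys) f ≡ ∑ₗ xs f + ∑ₗ ys f
∑ₗ-++ []       ys f = refl
∑ₗ-++ (x ∷ xs) ys f = trans (cong (f x +_) (∑ₗ-++ xs ys f)) (sym (+-assoc (f x) _ _))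

∑ₗ-map : ∀ (g : A → A′) (xs : List A) (f : A′ → ℕ) → ∑ₗ (map g xs) f ≡ ∑ₗ xs (f ∘ g)
∑ₗ-map g xs f = cong ListAction.sum (sym (List.map-∘ xs))

∑ₗ-+ : ∀ (xs : List A) (f g : A → ℕ) → ∑ₗ xs (λ x → f x + g x) ≡ ∑ₗ xs f + ∑ₗ xs g
∑ₗ-+ []       f g = refl
∑ₗ-+ (x ∷ xs) f g = trans (cong (f x + g x +_) (∑ₗ-+ xs f g)) (+-interchange (f x) (g x) _ _)
  where
  +-interchange : ∀ a b c d → a + b + (c + d) ≡ a + c + (b + d)
  +-interchange = solve-∀

∑ₗ-*ˡ : ∀ c (xs : List A) (f : A → ℕ) → ∑ₗ xs (λ x → c * f x) ≡ c * ∑ₗ xs f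
∑ₗ-*ˡ c []       f = sym (*-zeroʳ c)
∑ₗ-*ˡ c (x ∷ xs) f = trans (cong (c * f x +_) (∑ₗ-*ˡ c xs f)) (sym (*-distribˡ-+ c (f x) _))

∑ₗ-*ʳ : ∀ c (xs : List A) (f : A → ℕ) → ∑ₗ xs (λ x → f x * c) ≡ ∑ₗ xs f * c
∑ₗ-*ʳ c xs f = trans (∑ₗ-cong xs λ x → *-comm (f x) c) (trans (∑ₗ-*ˡ c xs f) (*-comm c _))

∑ₗ-one : (xs : List A) → ∑ₗ xs (λ _ → 1) ≡ length xs
∑ₗ-one []       = refl
∑ₗ-one (x ∷ xs) = cong suc (∑ₗ-one xs)

∑ₗ-sum : ∀ (xs : List A) (f : A → Fin n → ℕ) →
         ∑ₗ xs (λ x → sum (f x)) ≡ ∑[ i < n ] ∑ₗ xs (λ x → f x i)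
∑ₗ-sum {n = n} [] f = sym (sum-zero {n} _ λ _ → refl)
∑ₗ-sum (x ∷ xs) f =
  trans (cong (sum (f x) +_) (∑ₗ-sum xs f)) (sym (∑-distrib-+ (f x) _))

∑ₗ-∈ : ∀ {xs : List A} {x} (f : A → ℕ) → x ∈ xs → f x ≤ ∑ₗ xs f
∑ₗ-∈ f (here refl) = m≤m+n _ _
∑ₗ-∈ f (there x∈)  = ≤-trans (∑ₗ-∈ f x∈) (m≤n+m _ _)

length-filter≡∑ₗ : ∀ {P : A → Set} (P? : Decidable P) xs → length (filter P? xs) ≡ ∑ₗ xs (λ x → ⟦ P? x ⟧)
length-filter≡∑ₗ P? [] = refl
length-filter≡∑ₗ P? (x ∷ xs) with P? x
... | yes _ = cong suc (length-filter≡∑ₗ P? xs)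
... | no _  = length-filter≡∑ₗ P? xs

∑ₗ-filter : ∀ {P : A → Set} (P? : Decidable P) xs (f : A → ℕ) →
            ∑ₗ (filter P? xs) f ≡ ∑ₗ xs (λ x → ⟦ P? x ⟧ * f x)
∑ₗ-filter P? [] f = refl
∑ₗ-filter P? (x ∷ xs) f with P? x
... | yes _ = cong₂ _+_ (sym (+-identityʳ (f x))) (∑ₗ-filter P? xs f)
... | no _  = ∑ₗ-filter P? xs f

∑ₗ-cartesianProductWith : ∀ {C : Set} (g : A → A′ → C) xs ys (f : C → ℕ) →
  ∑ₗ (cartesianProductWith g xs ys) f ≡ ∑ₗ xs λ x → ∑ₗ ys λ y → f (g x y)
∑ₗ-cartesianProductWith g []       ys f = refl
∑ₗ-cartesianProductWith g (x ∷ xs) ys f =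
  trans (∑ₗ-++ (map (g x) ys) _ f)
        (cong₂ _+_ (∑ₗ-map (g x) ys f) (∑ₗ-cartesianProductWith g xs ys f))

∑ₗ-tabulate : ∀ (g : Fin n → A) (f : A → ℕ) → ∑ₗ (tabulate g) f ≡ sum (f ∘ g)
∑ₗ-tabulate {zero}  g f = refl
∑ₗ-tabulate {suc n} g f = cong (f (g zero) +_) (∑ₗ-tabulate (g ∘ suc) f)

-- Counting edges and arcs

-- Exchanging i and j in one half of the sum collects everything on `f i j`. The coefficient that
-- results is the indicator of `i ≢ j`.
∑-vertexPairs : ∀ (f : Fin n → Fin n → ℕ) →
  ∑ₗ (vertexPairs n) (λ (i , j) → f i j + f j i) ≡
  ∑[ i < n ] ∑[ j < n ] ((⟦ i Fin.<? j ⟧ + ⟦ j Fin.<? i ⟧) * f i j)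
∑-vertexPairs {n} f = begin
  ∑ₗ (vertexPairs n) (λ (i , j) → f i j + f j i)
    ≡⟨ ∑ₗ-filter (λ (i , j) → i Fin.<? j) (cartesianProduct (allFin n) (allFin n)) _ ⟩
  ∑ₗ (cartesianProduct (allFin n) (allFin n)) (λ (i , j) → lt i j * (f i j + f j i))
    ≡⟨ ∑ₗ-cartesianProductWith _,_ (allFin n) (allFin n) _ ⟩
  ∑ₗ (allFin n) (λ i → ∑ₗ (allFin n) λ j → lt i j * (f i j + f j i))
    ≡⟨ ∑ₗ-tabulate {n} id _ ⟩
  (∑[ i < n ] ∑ₗ (allFin n) λ j → lt i j * (f i j + f j i))
    ≡⟨ sum-cong-≗ {n} (λ i → ∑ₗ-tabulate {n} id _) ⟩
  (∑[ i < n ] ∑[ j < n ] (lt i j * (f i j + f j i)))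
    ≡⟨ sum-cong-≗ (λ i → trans (sum-cong-≗ λ j → *-distribˡ-+ (lt i j) (f i j) (f j i)) (∑-distrib-+ {n} _ _)) ⟩
  (∑[ i < n ] ((∑[ j < n ] (lt i j * f i j)) + (∑[ j < n ] (lt i j * f j i))))
    ≡⟨ ∑-distrib-+ {n} _ _ ⟩
  (∑[ i < n ] ∑[ j < n ] (lt i j * f i j)) + (∑[ i < n ] ∑[ j < n ] (lt i j * f j i))
    ≡⟨ cong ((∑[ i < n ] ∑[ j < n ] (lt i j * f i j)) +_) (∑-comm λ i j → lt i j * f j i) ⟩
  (∑[ i < n ] ∑[ j < n ] (lt i j * f i j)) + (∑[ i < n ] ∑[ j < n ] (lt j i * f i j))
    ≡⟨ ∑-distrib-+ {n} _ _ ⟨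
  (∑[ i < n ] ((∑[ j < n ] (lt i j * f i j)) + (∑[ j < n ] (lt j i * f i j))))
    ≡⟨ sum-cong-≗ (λ i → trans (sum-cong-≗ λ j → *-distribʳ-+ (f i j) (lt i j) (lt j i)) (∑-distrib-+ {n} _ _)) ⟨
  (∑[ i < n ] ∑[ j < n ] ((lt i j + lt j i) * f i j)) ∎
  where
  open ≡-Reasoning
  lt : Fin n → Fin n → ℕ
  lt i j = ⟦ i Fin.<? j ⟧

∑-vertexPairs≤ : ∀ (f : Fin n → Fin n → ℕ) →
  ∑ₗ (vertexPairs n) (λ (i , j) → f i j + f j i) ≤ ∑[ i < n ] ∑[ j < n ] f i j
∑-vertexPairs≤ f = ≤-trans (≤-reflexive (∑-vertexPairs f))
  (sum-mono-≤ λ i → sum-mono-≤ λ j →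
    ≤-trans (*-monoˡ-≤ (f i j) (atMostOne i j)) (≤-reflexive (*-identityˡ (f i j))))
  where
  atMostOne : ∀ {n} (i j : Fin n) → ⟦ i Fin.<? j ⟧ + ⟦ j Fin.<? i ⟧ ≤ 1
  atMostOne i j with i Fin.<? j | j Fin.<? i
  ... | yes p | yes q = contradiction q (Fin.<-asym {x = i} {y = j} p)
  ... | yes p | no _  = ≤-refl
  ... | no _  | d     = ⟦⟧≤1 d

∑≤∑-vertexPairs : ∀ (f : Fin n → Fin n → ℕ) → (∀ i → f i i ≡ 0) →
  ∑[ i < n ] ∑[ j < n ] f i j ≤ ∑ₗ (vertexPairs n) (λ (i , j) → f i j + f j i)
∑≤∑-vertexPairs f f≡0 = ≤-trans (sum-mono-≤ λ i → sum-mono-≤ λ j → step i j)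
                                (≤-reflexive (sym (∑-vertexPairs f)))
  where
  step : ∀ i j → f i j ≤ (⟦ i Fin.<? j ⟧ + ⟦ j Fin.<? i ⟧) * f i j
  step i j with i Fin.<? j | j Fin.<? i
  ... | yes _ | d     = ≤-trans (m≤m+n _ _) ≤-refl
  ... | no _  | yes _ = m≤m+n _ _
  ... | no p  | no q  = ≤-trans (≤-reflexive (trans (cong (f i) (sym i≡j)) (f≡0 i))) z≤n
    where
    i≡j : i ≡ j
    i≡j = Fin.toℕ-injective (≤-antisym (≮⇒≥ q) (≮⇒≥ p))

edgeCount≡∑ₗ : (G : Graph n) → edgeCount G ≡ ∑ₗ (vertexPairs n) (λ (i , j) → ⟦ adj G i j Bool.≟ true ⟧)
edgeCount≡∑ₗ {n} G = length-filter≡∑ₗ (λ (i , j) → adj G i j Bool.≟ true) (vertexPairs n)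

arcs≤2*edgeCount : (G : Graph n) →
  (∑[ i < n ] ∑[ j < n ] ⟦ adj G i j Bool.≟ true ⟧) ≤ 2 * edgeCount G
arcs≤2*edgeCount {n} G = begin
  (∑[ i < n ] ∑[ j < n ] arc i j)
    ≤⟨ ∑≤∑-vertexPairs arc (λ i → ⟦⟧-no (adj G i i Bool.≟ true) λ e → case trans (sym e) (irrefl G i) of λ ()) ⟩
  ∑ₗ (vertexPairs n) (λ (i , j) → arc i j + arc j i)
    ≡⟨ ∑ₗ-cong (vertexPairs n) (λ (i , j) → twice i j) ⟩
  ∑ₗ (vertexPairs n) (λ (i , j) → 2 * arc i j)
    ≡⟨ ∑ₗ-*ˡ 2 (vertexPairs n) _ ⟩
  2 * ∑ₗ (vertexPairs n) (λ (i , j) → arc i j)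
    ≡⟨ cong (2 *_) (edgeCount≡∑ₗ G) ⟨
  2 * edgeCount G ∎
  where
  open ≤-Reasoning
  arc : Fin n → Fin n → ℕ
  arc i j = ⟦ adj G i j Bool.≟ true ⟧
  twice : ∀ i j → arc i j + arc j i ≡ 2 * arc i j
  twice i j rewrite symm G j i = cong (arc i j +_) (sym (+-identityʳ _))

∑ₗ-comm : ∀ (xs : List A) (ys : List A′) (f : A → A′ → ℕ) →
          ∑ₗ xs (λ x → ∑ₗ ys (f x)) ≡ ∑ₗ ys (λ y → ∑ₗ xs (λ x → f x y))
∑ₗ-comm [] [] f = refl
∑ₗ-comm [] (y ∷ ys) f = ∑ₗ-comm [] ys f
∑ₗ-comm (x ∷ xs) ys f =
  trans (cong (∑ₗ ys (f x) +_) (∑ₗ-comm xs ys f)) (sym (∑ₗ-+ ys (f x) _))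

-- Uniform distributions on vectors

-- Independence of the coordinates, with expectations replaced by unnormalised sums.
∑-vectorsOver-product : ∀ (xs : List A) (g : Fin n → A → ℕ) →
  ∑ₗ (vectorsOver xs n) (λ v → product (λ i → g i (lookup v i))) ≡ product (λ i → ∑ₗ xs (g i))
∑-vectorsOver-product {n = zero}  xs g = refl
∑-vectorsOver-product {n = suc n} xs g = begin
  ∑ₗ (vectorsOver xs (suc n)) (λ v → product (λ i → g i (lookup v i)))
    ≡⟨ ∑ₗ-cartesianProductWith _∷_ xs (vectorsOver xs n) _ ⟩
  ∑ₗ xs (λ x → ∑ₗ (vectorsOver xs n) (λ v → g zero x * product (λ i → g (suc i) (lookup v i))))
    ≡⟨ ∑ₗ-cong xs (λ x → trans (∑ₗ-*ˡ (g zero x) (vectorsOver xs n) _)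
                               (cong (g zero x *_) (∑-vectorsOver-product xs (g ∘ suc)))) ⟩
  ∑ₗ xs (λ x → g zero x * product (λ i → ∑ₗ xs (g (suc i))))
    ≡⟨ ∑ₗ-*ʳ (product (λ i → ∑ₗ xs (g (suc i)))) xs (g zero) ⟩
  ∑ₗ xs (g zero) * product (λ i → ∑ₗ xs (g (suc i))) ∎
  where open ≡-Reasoning

∑-vectorsOver-+ : ∀ (xs : List A) j k (F : Vec A j → Vec A k → ℕ) →
  ∑ₗ (vectorsOver xs (j + k)) (λ v → F (take j v) (drop j v)) ≡
  ∑ₗ (vectorsOver xs j) (λ v → ∑ₗ (vectorsOver xs k) (F v))
∑-vectorsOver-+ xs zero    k F = sym (+-identityʳ _)
∑-vectorsOver-+ xs (suc j) k F =
  trans (∑ₗ-cartesianProductWith _∷_ xs (vectorsOver xs (j + k)) _)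
  (trans (∑ₗ-cong xs λ x → ∑-vectorsOver-+ xs j k (F ∘ (x ∷_)))
         (sym (∑ₗ-cartesianProductWith _∷_ xs (vectorsOver xs j) _)))

chunk : ∀ m {k} → Vec A (m * k) → Vec (Vec A k) m
chunk zero        v = []
chunk (suc m) {k} v = take k v ∷ chunk m (drop k v)

∑-vectorsOver-chunk : ∀ (xs : List A) m {k} (f : Vec (Vec A k) m → ℕ) →
  ∑ₗ (vectorsOver xs (m * k)) (λ v → f (chunk m v)) ≡ ∑ₗ (vectorsOver (vectorsOver xs k) m) f
∑-vectorsOver-chunk xs zero        f = refl
∑-vectorsOver-chunk xs (suc m) {k} f =
  trans (∑-vectorsOver-+ xs k (m * k) (λ x v → f (x ∷ chunk m v)))
  (trans (∑ₗ-cong (vectorsOver xs k) λ x → ∑-vectorsOver-chunk xs m (f ∘ (x ∷_)))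
         (sym (∑ₗ-cartesianProductWith _∷_ (vectorsOver xs k) (vectorsOver (vectorsOver xs k) m) f)))

-- Seeds are stored node by node, whereas an iteration uses one block of every node. Cutting the
-- seed of each node after `j` bits gives two independent families.
∑-vectorsOver-unzip : ∀ (xs : List A) j k n (F : Vec (Vec A j) n → Vec (Vec A k) n → ℕ) →
  ∑ₗ (vectorsOver (vectorsOver xs (j + k)) n) (λ ω → F (Vec.map (take j) ω) (Vec.map (drop j) ω)) ≡
  ∑ₗ (vectorsOver (vectorsOver xs j) n) (λ α → ∑ₗ (vectorsOver (vectorsOver xs k) n) (F α))
∑-vectorsOver-unzip xs j k zero    F = sym (+-identityʳ _)
∑-vectorsOver-unzip {A} xs j k (suc n) F = begin
  ∑ₗ (vectorsOver (vectorsOver xs (j + k)) (suc n)) _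
    ≡⟨ ∑ₗ-cartesianProductWith _∷_ (vectorsOver xs (j + k)) (vectorsOver (vectorsOver xs (j + k)) n) _ ⟩
  ∑ₗ (vectorsOver xs (j + k)) (λ x → ∑ₗ (vectorsOver (vectorsOver xs (j + k)) n) λ ω →
    F (take j x ∷ Vec.map (take j) ω) (drop j x ∷ Vec.map (drop j) ω))
    ≡⟨ ∑ₗ-cong (vectorsOver xs (j + k)) (λ x →
         ∑-vectorsOver-unzip xs j k n λ α β → F (take j x ∷ α) (drop j x ∷ β)) ⟩
  ∑ₗ (vectorsOver xs (j + k)) (λ x → ∑ₗ Ωⱼ λ α → ∑ₗ Ωₖ λ β → F (take j x ∷ α) (drop j x ∷ β))
    ≡⟨ ∑-vectorsOver-+ xs j k (λ a b → ∑ₗ Ωⱼ λ α → ∑ₗ Ωₖ λ β → F (a ∷ α) (b ∷ β)) ⟩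
  ∑ₗ (vectorsOver xs j) (λ a → ∑ₗ (vectorsOver xs k) λ b → ∑ₗ Ωⱼ λ α → ∑ₗ Ωₖ λ β → F (a ∷ α) (b ∷ β))
    ≡⟨ ∑ₗ-cong (vectorsOver xs j) (λ a → ∑ₗ-comm (vectorsOver xs k) Ωⱼ _) ⟩
  ∑ₗ (vectorsOver xs j) (λ a → ∑ₗ Ωⱼ λ α → ∑ₗ (vectorsOver xs k) λ b → ∑ₗ Ωₖ λ β → F (a ∷ α) (b ∷ β))
    ≡⟨ ∑ₗ-cong (vectorsOver xs j) (λ a → ∑ₗ-cong Ωⱼ λ α →
         ∑ₗ-cartesianProductWith _∷_ (vectorsOver xs k) Ωₖ (F (a ∷ α))) ⟨
  ∑ₗ (vectorsOver xs j) (λ a → ∑ₗ Ωⱼ λ α → ∑ₗ (vectorsOver (vectorsOver xs k) (suc n)) (F (a ∷ α)))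
    ≡⟨ ∑ₗ-cartesianProductWith _∷_ (vectorsOver xs j) Ωⱼ _ ⟨
  ∑ₗ (vectorsOver (vectorsOver xs j) (suc n)) (λ α → ∑ₗ (vectorsOver (vectorsOver xs k) (suc n)) (F α)) ∎
  where
  open ≡-Reasoning
  Ωⱼ : List (Vec (Vec A j) n)
  Ωⱼ = vectorsOver (vectorsOver xs j) n
  Ωₖ : List (Vec (Vec A k) n)
  Ωₖ = vectorsOver (vectorsOver xs k) n

length-vectorsOver : ∀ (xs : List A) n → length (vectorsOver xs n) ≡ length xs ^ n
length-vectorsOver xs zero    = refl
length-vectorsOver xs (suc n) = begin
  length (vectorsOver xs (suc n))
    ≡⟨ ∑ₗ-one (vectorsOver xs (suc n)) ⟨
  ∑ₗ (vectorsOver xs (suc n)) (λ _ → 1)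
    ≡⟨ ∑ₗ-cartesianProductWith _∷_ xs (vectorsOver xs n) (λ _ → 1) ⟩
  ∑ₗ xs (λ _ → ∑ₗ (vectorsOver xs n) (λ _ → 1))
    ≡⟨ ∑ₗ-cong xs (λ _ → trans (∑ₗ-one (vectorsOver xs n)) (trans (length-vectorsOver xs n) (sym (*-identityˡ _)))) ⟩
  ∑ₗ xs (λ _ → 1 * length xs ^ n)
    ≡⟨ ∑ₗ-*ʳ (length xs ^ n) xs (λ _ → 1) ⟩
  ∑ₗ xs (λ _ → 1) * length xs ^ n
    ≡⟨ cong (_* length xs ^ n) (∑ₗ-one xs) ⟩
  length xs * length xs ^ n ∎
  where open ≡-Reasoning

∈-vectorsOver : ∀ {xs : List A} → (∀ x → x ∈ xs) → (v : Vec A n) → v ∈ vectorsOver xs n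
∈-vectorsOver all []      = here refl
∈-vectorsOver all (x ∷ v) = ∈-cartesianProductWith⁺ _∷_ (all x) (∈-vectorsOver all v)

∈-allBits : ∀ {r} (x : Bits r) → x ∈ allBits r
∈-allBits = ∈-vectorsOver λ where
  false → here refl
  true  → there (here refl)

-- Binary values of bit vectors

toNat : ∀ {k} → Bits k → ℕ
toNat []              = 0
toNat (false ∷ bs)    = toNat bs
toNat {suc k} (true ∷ bs) = 2 ^ k + toNat bs

toNat-zeros : ∀ k → toNat (Vec.replicate k false) ≡ 0
toNat-zeros zero    = refl
toNat-zeros (suc k) = toNat-zeros k

∑-toNat : ∀ k (f : ℕ → ℕ) → ∑ₗ (allBits k) (f ∘ toNat) ≡ ∑[ i < 2 ^ k ] f (toℕ i)
∑-toNat zero    f = refl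
∑-toNat (suc k) f = begin
  ∑ₗ (allBits (suc k)) (f ∘ toNat)
    ≡⟨ ∑ₗ-cartesianProductWith _∷_ (false ∷ true ∷ []) (allBits k) _ ⟩
  ∑ₗ (allBits k) (f ∘ toNat) + (∑ₗ (allBits k) (λ b → f (2 ^ k + toNat b)) + 0)
    ≡⟨ cong₂ (λ x y → x + (y + 0)) (∑-toNat k f) (∑-toNat k (f ∘ (2 ^ k +_))) ⟩
  (∑[ i < 2 ^ k ] f (toℕ i)) + ((∑[ i < 2 ^ k ] f (2 ^ k + toℕ i)) + 0)
    ≡⟨ cong ((∑[ i < 2 ^ k ] f (toℕ i)) +_) (+-identityʳ _) ⟩
  (∑[ i < 2 ^ k ] f (toℕ i)) + (∑[ i < 2 ^ k ] f (2 ^ k + toℕ i))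
    ≡⟨ sum-toℕ-+ (2 ^ k) (2 ^ k) f ⟨
  (∑[ i < 2 ^ k + 2 ^ k ] f (toℕ i))
    ≡⟨ cong (λ m → ∑[ i < m ] f (toℕ i)) (cong (2 ^ k +_) (+-identityʳ (2 ^ k))) ⟨
  (∑[ i < 2 ^ suc k ] f (toℕ i)) ∎
  where open ≡-Reasoning

-- Amplification by independent repetition

-- Bernoulli's inequality (1 + 1/k)^T ≥ 1 + T/k with denominators cleared: for positive `F`, the
-- hypothesis `F ≤ k * s` means N / F ≥ 1 + 1/k.
[k+T]F^T≤kN^T : ∀ {F s N k} → F + s ≡ N → F ≤ k * s → ∀ T → (k + T) * F ^ T ≤ k * N ^ T
[k+T]F^T≤kN^T {F} {s} {N} {k} F+s≡N F≤ks zero = ≤-reflexive (cong (_* 1) (+-identityʳ k))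
[k+T]F^T≤kN^T {F} {s} {N} {k} F+s≡N F≤ks (suc T) = begin
  (k + suc T) * (F * F ^ T)             ≡⟨ expand k T F (F ^ T) ⟩
  (k + T) * F ^ T * F + F ^ T * F       ≤⟨ +-monoʳ-≤ ((k + T) * F ^ T * F) (*-monoʳ-≤ (F ^ T) F≤ks) ⟩
  (k + T) * F ^ T * F + F ^ T * (k * s) ≤⟨ m≤m+n _ (T * F ^ T * s) ⟩
  (k + T) * F ^ T * F + F ^ T * (k * s) + T * F ^ T * s ≡⟨ collect k T F s (F ^ T) ⟩
  (k + T) * F ^ T * (F + s)             ≡⟨ cong ((k + T) * F ^ T *_) F+s≡N ⟩
  (k + T) * F ^ T * N                   ≤⟨ *-monoˡ-≤ N ([k+T]F^T≤kN^T {k = k} F+s≡N F≤ks T) ⟩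
  k * N ^ T * N                         ≡⟨ reorder k (N ^ T) N ⟩
  k * (N * N ^ T)                       ∎
  where
  open ≤-Reasoning
  expand : ∀ k T F P → (k + suc T) * (F * P) ≡ (k + T) * P * F + P * F
  expand = solve-∀
  collect : ∀ k T F s P → (k + T) * P * F + P * (k * s) + T * P * s ≡ (k + T) * P * (F + s)
  collect = solve-∀
  reorder : ∀ k P N → k * P * N ≡ k * (N * P)
  reorder = solve-∀

-- With T = 2k the factor k + T is 3k, which brings the failure probability down to 1/3.
3F^T≤N^T : ∀ {F s N k} .{{_ : NonZero k}} → F + s ≡ N → F ≤ k * s →
           3 * F ^ (2 * k) ≤ N ^ (2 * k)
3F^T≤N^T {F} {s} {N} {k} F+s≡N F≤ks = *-cancelˡ-≤ k (begin
  k * (3 * F ^ (2 * k))       ≡⟨ triple k (F ^ (2 * k)) ⟩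
  (k + 2 * k) * F ^ (2 * k)   ≤⟨ [k+T]F^T≤kN^T {k = k} F+s≡N F≤ks (2 * k) ⟩
  k * N ^ (2 * k)             ∎)
  where
  open ≤-Reasoning
  triple : ∀ k P → k * (3 * P) ≡ (k + 2 * k) * P
  triple = solve-∀

-- The seed of a node consists of T blocks of B bits, one per repetition; s is
-- the indicator of success of one repetition.
module _ {n B : ℕ} (s : Vec (Bits B) n → ℕ) where

  -- The indicator that all `T` repetitions fail, written as a product over blocks so that
  -- independence applies.
  failsAll : ∀ T → Vec (Bits (T * B)) n → ℕ
  failsAll zero    ω = 1
  failsAll (suc T) ω = (1 ∸ s (Vec.map (take B) ω)) * failsAll T (Vec.map (drop B) ω)

  private
    Ω : ∀ r → List (Vec (Bits r) n)
    Ω r = vectorsOver (allBits r) n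

  ∑-failsAll : ∀ T → ∑ₗ (Ω (T * B)) (failsAll T) ≡ ∑ₗ (Ω B) (λ α → 1 ∸ s α) ^ T
  ∑-failsAll zero = trans (∑ₗ-one (Ω 0)) (trans (length-vectorsOver (allBits 0) n) (^-zeroˡ n))
  ∑-failsAll (suc T) = begin
    ∑ₗ (Ω (B + T * B)) (failsAll (suc T))
      ≡⟨ ∑-vectorsOver-unzip (false ∷ true ∷ []) B (T * B) n (λ α β → (1 ∸ s α) * failsAll T β) ⟩
    ∑ₗ (Ω B) (λ α → ∑ₗ (Ω (T * B)) λ β → (1 ∸ s α) * failsAll T β)
      ≡⟨ ∑ₗ-cong (Ω B) (λ α → trans (∑ₗ-*ˡ (1 ∸ s α) (Ω (T * B)) _) (cong ((1 ∸ s α) *_) (∑-failsAll T))) ⟩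
    ∑ₗ (Ω B) (λ α → (1 ∸ s α) * ∑ₗ (Ω B) (λ α → 1 ∸ s α) ^ T)
      ≡⟨ ∑ₗ-*ʳ (∑ₗ (Ω B) (λ α → 1 ∸ s α) ^ T) (Ω B) _ ⟩
    ∑ₗ (Ω B) (λ α → 1 ∸ s α) * ∑ₗ (Ω B) (λ α → 1 ∸ s α) ^ T ∎
    where open ≡-Reasoning

  length-Ω : ∀ T → length (Ω (T * B)) ≡ length (Ω B) ^ T
  length-Ω T = begin
    length (Ω (T * B))            ≡⟨ length-vectorsOver (allBits (T * B)) n ⟩
    length (allBits (T * B)) ^ n  ≡⟨ cong (_^ n) (length-vectorsOver _ (T * B)) ⟩
    (2 ^ (T * B)) ^ n             ≡⟨ ^-*-assoc 2 (T * B) n ⟩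
    2 ^ (T * B * n)               ≡⟨ cong (2 ^_) (reorder T B n) ⟩
    2 ^ (B * n * T)               ≡⟨ ^-*-assoc 2 (B * n) T ⟨
    (2 ^ (B * n)) ^ T             ≡⟨ cong (_^ T) (^-*-assoc 2 B n) ⟨
    ((2 ^ B) ^ n) ^ T             ≡⟨ cong (λ m → (m ^ n) ^ T) (length-vectorsOver _ B) ⟨
    (length (allBits B) ^ n) ^ T  ≡⟨ cong (_^ T) (length-vectorsOver (allBits B) n) ⟨
    length (Ω B) ^ T              ∎
    where
    open ≡-Reasoning
    reorder : ∀ T B n → T * B * n ≡ B * n * T
    reorder = solve-∀

  -- Each seed satisfies `P` or is counted by `failsAll`, and the latter make up at most a third of
  -- all seeds: a single repetition succeeds with probability at least 1/k.
  amplify : ∀ k .{{_ : NonZero k}} {P : Vec (Bits ((2 * k) * B)) n → Set} (P? : Decidable P) →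
            (∀ α → s α ≤ 1) → length (Ω B) ≤ k * ∑ₗ (Ω B) s →
            (∀ ω → P ω ⊎ 1 ≤ failsAll (2 * k) ω) → ProbAtLeast⅔ P?
  amplify k {P} P? s≤1 often outcome = +-cancelʳ-≤ N _ _ (begin
    2 * N + N                              ≡⟨ triple N ⟩
    3 * N                                  ≤⟨ *-monoʳ-≤ 3 cover ⟩
    3 * (count + F ^ T)                    ≡⟨ *-distribˡ-+ 3 count (F ^ T) ⟩
    3 * count + 3 * F ^ T                  ≤⟨ +-monoʳ-≤ (3 * count) (3F^T≤N^T {k = k} F+S F≤kS) ⟩
    3 * count + length (Ω B) ^ T           ≡⟨ cong (3 * count +_) (length-Ω T) ⟨
    3 * count + N                          ∎)
    where
    open ≤-Reasoning
    T = 2 * k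
    N = length (Ω (T * B))
    count = length (filter P? (Ω (T * B)))
    F = ∑ₗ (Ω B) (λ α → 1 ∸ s α)
    triple : ∀ N → 2 * N + N ≡ 3 * N
    triple = solve-∀
    F+S : F + ∑ₗ (Ω B) s ≡ length (Ω B)
    F+S = trans (sym (∑ₗ-+ (Ω B) (λ α → 1 ∸ s α) s))
          (trans (∑ₗ-cong (Ω B) λ α → m∸n+n≡m (s≤1 α)) (∑ₗ-one (Ω B)))
    F≤kS : F ≤ k * ∑ₗ (Ω B) s
    F≤kS = ≤-trans (≤-trans (m≤m+n F _) (≤-reflexive F+S)) often
    pointwise : ∀ ω → 1 ≤ ⟦ P? ω ⟧ + failsAll T ω
    pointwise ω with P? ω | outcome ω
    ... | yes _ | _      = s≤s z≤n
    ... | no ¬p | inj₁ p = contradiction p ¬p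
    ... | no ¬p | inj₂ 1≤f = 1≤f
    cover : N ≤ count + F ^ T
    cover = begin
      N                                                        ≡⟨ ∑ₗ-one (Ω (T * B)) ⟨
      ∑ₗ (Ω (T * B)) (λ _ → 1)                                 ≤⟨ ∑ₗ-mono-≤ (Ω (T * B)) pointwise ⟩
      ∑ₗ (Ω (T * B)) (λ ω → ⟦ P? ω ⟧ + failsAll T ω)           ≡⟨ ∑ₗ-+ (Ω (T * B)) _ (failsAll T) ⟩
      ∑ₗ (Ω (T * B)) (λ ω → ⟦ P? ω ⟧) + ∑ₗ (Ω (T * B)) (failsAll T)
        ≡⟨ cong₂ _+_ (sym (length-filter≡∑ₗ P? (Ω (T * B)))) (∑-failsAll T) ⟩
      count + F ^ T                                            ∎

-- Elimination orders of forests

unique-++⁻ˡ : ∀ {A : Set} (xs : List A) {ys} → Unique (xs ++ ys) → Unique xs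
unique-++⁻ˡ []       uniq       = []
unique-++⁻ˡ (x ∷ xs) (x∉ ∷ uniq) = All.++⁻ˡ xs x∉ ∷ unique-++⁻ˡ xs uniq

unique⇒lookup-injective : ∀ {A : Set} {xs : List A} → Unique xs → Injective _≡_ _≡_ (List.lookup xs)
unique⇒lookup-injective (x∉ ∷ _)  {zero}  {zero}  eq = refl
unique⇒lookup-injective {xs = _ ∷ xs} (x∉ ∷ _) {zero}  {suc j} eq = contradiction eq (All.lookup x∉ (∈-lookup {xs = xs} j))
unique⇒lookup-injective {xs = _ ∷ xs} (x∉ ∷ _) {suc i} {zero}  eq = contradiction (sym eq) (All.lookup x∉ (∈-lookup {xs = xs} i))
unique⇒lookup-injective (_ ∷ uniq) {suc i} {suc j} eq = cong suc (unique⇒lookup-injective uniq eq)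

unique⇒length≤ : ∀ {h} {xs : List (Fin h)} → Unique xs → length xs ≤ h
unique⇒length≤ uniq = Fin.injective⇒≤ (unique⇒lookup-injective uniq)

module _ {h : ℕ} (H : Graph h) where

  open DecMembership (Fin._≟_ {h}) using (_∈?_)

  -- At most one neighbour in `xs`, possibly none, so that an isolated vertex counts as a leaf.
  Leaf : List (Fin h) → Fin h → Set
  Leaf xs x = ∀ {i j} → i ∈ xs → j ∈ xs → Adj H x i → Adj H x j → i ≡ j

  -- Read from the end, this is an order of placement: the head is placed last and then has at most
  -- one placed neighbour. Such an order of a vertex set exists exactly if the set induces a forest.
  data EliminationOrder : List (Fin h) → Set where
    []  : EliminationOrder []
    elim : ∀ {x xs} → x ∉ xs → Leaf xs x → EliminationOrder xs → EliminationOrder (x ∷ xs)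

  linked-close : ∀ w as {z bs x} → Linked (Adj H) (w ∷ as ++ z ∷ bs) → Adj H z x →
                 Linked (Adj H) (w ∷ (as ++ [ z ]) ++ [ x ])
  linked-close w []       (r ∷ _) e = r ∷ e ∷ [-]
  linked-close w (a ∷ as) (r ∷ l) e = r ∷ linked-close a as l e

  Branching : List (Fin h) → Fin h → Set
  Branching xs x = ∃[ i ] ∃[ j ] (i ∈ xs × j ∈ xs × Adj H x i × Adj H x j × i ≢ j)

  branching? : ∀ xs → Decidable (Branching xs)
  branching? xs x = Fin.any? λ i → Fin.any? λ j →
    (i ∈? xs) ×-dec (j ∈? xs) ×-dec (adj H x i Bool.≟ true) ×-dec (adj H x j Bool.≟ true) ×-dec ¬? (i Fin.≟ j)

  ¬branching⇒leaf : ∀ {xs x} → ¬ Branching xs x → Leaf xs x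
  ¬branching⇒leaf ¬b {i} {j} i∈ j∈ xi xj = decidable-stable (i Fin.≟ j) λ i≢j →
    ¬b (i , j , i∈ , j∈ , xi , xj , i≢j)

  module _ {u v : Fin h} (meets : EveryCycleMeets H u v) where

    -- A path in which every vertex branches can be prolonged forever, unless
    -- the next vertex closes a cycle.
    ¬all-branching : ∀ {xs} → u ∉ xs → v ∉ xs → (∀ {x} → x ∈ xs → Branching xs x) →
      ∀ k {x y rest} → h < k + length (x ∷ y ∷ rest) → All (_∈ xs) (x ∷ y ∷ rest) →
      Unique (x ∷ y ∷ rest) → Linked (Adj H) (x ∷ y ∷ rest) → ⊥
    -- `k` bounds how often the path can still grow; at zero it would have more than `h` distinct
    -- vertices.
    ¬all-branching u∉ v∉ branch zero h< all uniq linked = <⇒≱ h< (unique⇒length≤ uniq)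
    ¬all-branching {xs} u∉ v∉ branch (suc k) {x} {y} {rest} h< all@(x∈ ∷ _) uniq linked =
      case next of λ (z , z∈ , xz , z≢y) → prolong z z∈ xz z≢y
      where
      next : ∃[ z ] (z ∈ xs × Adj H x z × z ≢ y)
      next with branch x∈
      ... | i , j , i∈ , j∈ , xi , xj , i≢j with i Fin.≟ y
      ... | no i≢y   = i , i∈ , xi , i≢y
      ... | yes refl = j , j∈ , xj , i≢j ∘ sym

      prolong : ∀ z → z ∈ xs → Adj H x z → z ≢ y → ⊥
      prolong z z∈ xz z≢y with z ∈? (x ∷ y ∷ rest)
      ... | no z∉ = ¬all-branching u∉ v∉ branch k
              (subst (h <_) (sym (+-suc k _)) h<) (z∈ ∷ all)
              (All.¬Any⇒All¬ _ z∉ ∷ uniq) (Adj-sym H xz ∷ linked)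
      ... | yes (here refl) = case trans (sym xz) (irrefl H x) of λ ()
      ... | yes (there (here z≡y)) = z≢y z≡y
      ... | yes (there (there z∈rest)) with ∈-∃++ z∈rest
      -- `z` lies beyond `y` on the path, so the stretch from `x` to `z` has at least three
      -- vertices. The edge between `z` and `x` closes it to a cycle inside `xs`, hence avoiding `u`
      -- and `v`.
      ... | as , bs , refl = hits (meets x cycle (s≤s (∈-length {xs = as ++ [ z ]} z∈cycle) ,
              unique-++⁻ˡ (x ∷ cycle) (subst Unique split uniq) ,
              linked-close x (y ∷ as) linked (Adj-sym H xz)))
        where
        cycle : List (Fin h)
        cycle = y ∷ as ++ [ z ]
        z∈cycle : z ∈ as ++ [ z ]
        z∈cycle = Any.++⁺ʳ as (here refl)
        split : x ∷ y ∷ as ++ z ∷ bs ≡ (x ∷ cycle) ++ bs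
        split = cong (λ l → x ∷ y ∷ l) (sym (List.++-assoc as [ z ] bs))
        inside : All (_∈ xs) (x ∷ cycle)
        inside = All.++⁻ˡ (x ∷ cycle) (subst (All (_∈ xs)) split all)
        hits : u ∈ x ∷ cycle ⊎ v ∈ x ∷ cycle → ⊥
        hits (inj₁ u∈) = u∉ (All.lookup inside u∈)
        hits (inj₂ v∈) = v∉ (All.lookup inside v∈)

    ∃leaf : ∀ {xs x} → u ∉ xs → v ∉ xs → x ∈ xs → ∃[ y ] (y ∈ xs × Leaf xs y)
    ∃leaf {xs} {x} u∉ v∉ x∈ with All.all? (branching? xs) xs
    ... | no ¬all = let y , y∈ , ¬b = find (All.¬All⇒Any¬ (branching? xs) xs ¬all)
                    in y , y∈ , λ {i} {j} → ¬branching⇒leaf ¬b {i} {j}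
    ... | yes all with All.lookup all x∈
    ... | y , _ , y∈ , _ , xy , _ = contradiction
            (¬all-branching u∉ v∉ (All.lookup all) h {x} {y} {[]}
               (≤-trans (n<1+n h) (≤-trans (m≤n+m (suc h) 1) (≤-reflexive (+-comm 2 h))))
               (x∈ ∷ y∈ ∷ []) (((λ { refl → case trans (sym xy) (irrefl H x) of λ () }) ∷ []) ∷ [] ∷ []) (xy ∷ [-]))
            id

    -- Without one of its leaves the list still avoids `u` and `v`, so it has a leaf again. The
    -- recursion is on the length bound `k`, since the filtered list is not a structural part of
    -- `xs`.
    order : ∀ k xs → length xs ≤ k → u ∉ xs → v ∉ xs →
            ∃[ ys ] (EliminationOrder ys × (∀ {x} → x ∈ xs → x ∈ ys) × (∀ {x} → x ∈ ys → x ∈ xs))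
    order k       []           _  u∉ v∉ = [] , [] , id , id
    order (suc k) xs@(x ∷ xs′) len u∉ v∉ with ∃leaf u∉ v∉ (here {xs = xs′} (refl {x = x}))
    ... | y , y∈ , leaf = y ∷ ys , elim y∉ys leaf′ eliminable , to , from
      where
      ≢y? : Decidable (_≢ y)
      ≢y? z = ¬? (z Fin.≟ y)
      rest : List (Fin h)
      rest = filter ≢y? xs
      shorter : length rest ≤ k
      shorter = s≤s⁻¹ (≤-trans (List.filter-notAll ≢y? xs (Any.map (λ { refl ¬p → ¬p refl }) y∈)) len)
      ih = order k rest shorter (u∉ ∘ proj₁ ∘ ∈-filter⁻ ≢y?) (v∉ ∘ proj₁ ∘ ∈-filter⁻ ≢y?)
      ys = proj₁ ih
      eliminable = proj₁ (proj₂ ih)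
      to-ys = proj₁ (proj₂ (proj₂ ih))
      from-ys : ∀ {z} → z ∈ ys → z ∈ rest
      from-ys = proj₂ (proj₂ (proj₂ ih))
      y∉ys : y ∉ ys
      y∉ys y∈ys = proj₂ (∈-filter⁻ ≢y? {xs = xs} (from-ys y∈ys)) refl
      from-ys′ : ∀ {z} → z ∈ ys → z ∈ xs
      from-ys′ z∈ = proj₁ (∈-filter⁻ ≢y? (from-ys z∈))
      leaf′ : Leaf ys y
      leaf′ i∈ j∈ = leaf (from-ys′ i∈) (from-ys′ j∈)
      to : ∀ {z} → z ∈ xs → z ∈ y ∷ ys
      to {z} z∈ with z Fin.≟ y
      ... | yes z≡y = here z≡y
      ... | no z≢y  = there (to-ys (∈-filter⁺ ≢y? z∈ z≢y))
      from : ∀ {z} → z ∈ y ∷ ys → z ∈ xs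
      from (here refl) = y∈
      from (there z∈)  = from-ys′ z∈

    others : List (Fin h)
    others = filter (λ x → ¬? (x Fin.≟ u) ×-dec ¬? (x Fin.≟ v)) (allFin h)

    eliminationOrder : ∃[ ys ] (EliminationOrder ys × (∀ {x} → x ≢ u → x ≢ v → x ∈ ys) ×
                                (∀ {x} → x ∈ ys → x ≢ u × x ≢ v))
    eliminationOrder =
      let ys , o , to , from = order (length others) others ≤-refl
                                 (λ u∈ → proj₁ (proj₂ (∈-filter⁻ P? {xs = allFin h} u∈)) refl)
                                 (λ v∈ → proj₂ (proj₂ (∈-filter⁻ P? {xs = allFin h} v∈)) refl)
      in ys , o , (λ x≢u x≢v → to (∈-filter⁺ P? (∈-allFin _) (x≢u , x≢v))) , proj₂ ∘ ∈-filter⁻ P? {xs = allFin h} ∘ from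
      where
      P? : Decidable (λ x → x ≢ u × x ≢ v)
      P? x = ¬? (x Fin.≟ u) ×-dec ¬? (x Fin.≟ v)

  -- Distances in a connected graph

  -- `source` is available at every `k`, so `k` bounds a distance instead of being the exact length
  -- of a walk.
  data Within (u : Fin h) : ℕ → Fin h → Set where
    source : ∀ {k} → Within u k u
    hop    : ∀ {k i j} → Within u k i → Adj H i j → Within u (suc k) j

  within-mono : ∀ {u k k′ i} → k ≤ k′ → Within u k i → Within u k′ i
  within-mono k≤k′       source      = source
  within-mono (s≤s k≤k′) (hop w e) = hop (within-mono k≤k′ w) e

  star⇒within : ∀ {u k i j} → Within u k i → Star (Adj H) i j → ∃[ k′ ] Within u k′ j
  star⇒within w Star.ε         = _ , w
  star⇒within w (e Star.◅ s) = star⇒within (hop w e) s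

  radius : Connected H → ∀ u → ∃[ L ] ∀ i → Within u L i
  -- The sum of the walk lengths is a crude common bound, but it depends on `H` and `u` only.
  radius connected u = sum dist , λ i → within-mono (term≤sum dist i) (proj₂ (walk i))
    where
    walk : ∀ i → ∃[ k ] Within u k i
    walk i = star⇒within (source {k = 0}) (connected u i)
    dist : Fin h → ℕ
    dist i = proj₁ (walk i)

-- From nested candidate sets to a copy of H

module _ {h n : ℕ} (H : Graph h) (G : Graph n) {u v : Fin h} (uv : Adj H u v)
         (Candidate : ℕ → Fin h → Fin n → Set)
         (weaken : ∀ {s i x} → Candidate (suc s) i x → Candidate s i x)
         (extend : ∀ {s i j x} → Candidate (suc s) i x → Adj H i j → ∃[ y ] (Adj G x y × Candidate s j y))
         (disjoint : ∀ {i j x} → Candidate 0 i x → Candidate 0 j x → i ≡ j)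
         (unique-u : ∀ {x y} → Candidate 0 u x → Candidate 0 u y → x ≡ y)
         (unique-v : ∀ {x y} → Candidate 0 v x → Candidate 0 v y → x ≡ y)
  where

  open DecMembership (Fin._≟_ {h}) using (_∈?_)

  weaken-by : ∀ k {s i x} → Candidate (k + s) i x → Candidate s i x
  weaken-by zero    c = c
  weaken-by (suc k) c = weaken-by k (weaken c)

  -- Each hop of the walk spends one level; the levels that a shorter walk leaves over are dropped.
  reach : ∀ {k s i x} → Within H u k i → Candidate (k + s) u x → ∃[ y ] Candidate s i y
  reach {k} source c = _ , weaken-by k c
  reach {suc k} {s} {x = x} (hop w e) c =
    let y , cy = reach {k} {suc s} w (subst (λ t → Candidate t u x) (sym (+-suc k s)) c)
        z , _ , cz = extend cy e
    in z , cz

  -- The roles are placed from the end of the elimination order, at one level each; the `L` levels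
  -- in reserve pay for the walk to a role without placed neighbours. Injectivity and the edges at
  -- `u` and `v` are left to the next lemma.
  embed-forest : ∀ {L} → (∀ i → Within H u L i) → ∀ {ys} → EliminationOrder H ys →
    ∀ s {x} → Candidate (length ys + (L + s)) u x →
    Σ[ f ∈ (Fin h → Fin n) ] ((∀ {i} → i ∈ ys → Candidate s i (f i)) ×
            (∀ {i j} → i ∈ ys → j ∈ ys → Adj H i j → Adj G (f i) (f j)))
  embed-forest within [] s {x} c = (λ _ → x) , (λ ()) , (λ ())
  embed-forest {L} within {y ∷ ys} (elim y∉ leaf o) s {x} c
    with embed-forest {L} within o (suc s) (subst (λ t → Candidate t u x) (suc-moves (length ys) L s) c)
    where
    suc-moves : ∀ a b s → suc (a + (b + s)) ≡ a + (b + suc s)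
    suc-moves a b s = trans (sym (+-suc a (b + s))) (cong (a +_) (sym (+-suc b s)))
  ... | f , cand , edge = g , cand′ , edge′
    where
    image : ∃[ z ] (Candidate s y z × (∀ {i} → i ∈ ys → Adj H y i → Adj G z (f i)))
    image with Any.any? (λ i → adj H y i Bool.≟ true) ys
    -- By the leaf property all placed neighbours of `y` coincide with the one found, so a single
    -- `extend` provides every edge from `y` into `ys`.
    ... | yes some = let i , i∈ , yi = find some
                         z , fi-z , cz = extend (cand i∈) (Adj-sym H yi)
                     in z , cz , λ j∈ yj → subst (λ k → Adj G z (f k)) (leaf i∈ j∈ yi yj) (Adj-sym G fi-z)
    -- Here `y` opens a new tree of the forest. Any candidate for it will do, and a walk in `H` from
    -- `u` leads to one.
    ... | no none  = let z , cz = reach {L} {s} (within y) (weaken-by (length (y ∷ ys)) c)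
                     in z , cz , λ i∈ yi → contradiction (lose i∈ yi) none
    z = proj₁ image
    g : Fin h → Fin n
    g i with i Fin.≟ y
    ... | yes _ = z
    ... | no _  = f i
    g-y : g y ≡ z
    g-y with y Fin.≟ y
    ... | yes _   = refl
    ... | no y≢y  = contradiction refl y≢y
    g-ys : ∀ {i} → i ∈ ys → g i ≡ f i
    g-ys {i} i∈ with i Fin.≟ y
    ... | yes refl = contradiction i∈ y∉
    ... | no _     = refl
    cand′ : ∀ {i} → i ∈ y ∷ ys → Candidate s i (g i)
    cand′ (here refl) = subst (Candidate s _) (sym g-y) (proj₁ (proj₂ image))
    cand′ (there i∈)  = subst (Candidate s _) (sym (g-ys i∈)) (weaken (cand i∈))
    edge′ : ∀ {i j} → i ∈ y ∷ ys → j ∈ y ∷ ys → Adj H i j → Adj G (g i) (g j)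
    edge′ {i} (here refl) (here refl) e = case trans (sym e) (irrefl H i) of λ ()
    edge′ (here refl) (there j∈)  e = subst₂ (Adj G) (sym g-y) (sym (g-ys j∈)) (proj₂ (proj₂ image) j∈ e)
    edge′ (there i∈)  (here refl) e = subst₂ (Adj G) (sym (g-ys i∈)) (sym g-y)
                                        (Adj-sym G (proj₂ (proj₂ image) i∈ (Adj-sym H e)))
    edge′ (there i∈)  (there j∈)  e = subst₂ (Adj G) (sym (g-ys i∈)) (sym (g-ys j∈)) (edge i∈ j∈ e)

  -- The levels are one for each vertex of the forest, `L` for walks, and a last one for the edges
  -- at `u` and `v`: following such an edge from a candidate of level 1 yields some candidate for
  -- `u` or `v`, which uniqueness identifies with the chosen image. Injectivity holds because
  -- different roles have disjoint candidate sets.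
  candidate⇒contains : ∀ {L} → (∀ i → Within H u L i) → ∀ {ys} → EliminationOrder H ys →
    (∀ {i} → i ≢ u → i ≢ v → i ∈ ys) →
    ∀ {x} → Candidate (length ys + (L + 1)) u x → Contains G H
  candidate⇒contains {L} within {ys} o covers {x} c
    with embed-forest {L} within o 1 c
  ... | f , cand , edge = g , g-injective , λ i j e → g-edge e
    where
    cand-u : Candidate 1 u x
    cand-u = weaken-by L (weaken-by (length ys) c)
    v-image : ∃[ y ] (Adj G x y × Candidate 0 v y)
    v-image = extend cand-u uv
    g : Fin h → Fin n
    g i with i Fin.≟ u | i Fin.≟ v
    ... | yes _ | _     = x
    ... | no _  | yes _ = proj₁ v-image
    ... | no _  | no _  = f i
    g-cand : ∀ i → Candidate 0 i (g i)
    g-cand i with i Fin.≟ u | i Fin.≟ v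
    ... | yes refl | _        = weaken cand-u
    ... | no _     | yes refl = proj₂ (proj₂ v-image)
    ... | no i≢u   | no i≢v   = weaken (cand (covers i≢u i≢v))
    g-injective : Injective _≡_ _≡_ g
    g-injective {i} {j} eq = disjoint (g-cand i) (subst (Candidate 0 j) (sym eq) (g-cand j))
    g-u : ∀ {y} → Candidate 0 u y → y ≡ g u
    g-u cy = unique-u cy (g-cand u)
    g-v : ∀ {y} → Candidate 0 v y → y ≡ g v
    g-v cy = unique-v cy (g-cand v)
    to-u : ∀ {i} → Candidate 1 i (g i) → Adj H i u → Adj G (g i) (g u)
    to-u ci e = let y , a , cy = extend ci e in subst (Adj G _) (g-u cy) a
    to-v : ∀ {i} → Candidate 1 i (g i) → Adj H i v → Adj G (g i) (g v)
    to-v ci e = let y , a , cy = extend ci e in subst (Adj G _) (g-v cy) a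
    ys? : ∀ i → i ≡ u ⊎ i ≡ v ⊎ (i ∈ ys × g i ≡ f i)
    ys? i with i Fin.≟ u | i Fin.≟ v
    ... | yes p  | _     = inj₁ p
    ... | no _   | yes q = inj₂ (inj₁ q)
    ... | no i≢u | no i≢v = inj₂ (inj₂ (covers i≢u i≢v , refl))
    cand-f : ∀ {i} → i ∈ ys → g i ≡ f i → Candidate 1 i (g i)
    cand-f i∈ eq = subst (Candidate 1 _) (sym eq) (cand i∈)
    cand-g-u : Candidate 1 u (g u)
    cand-g-u = subst (Candidate 1 u) (g-u (weaken cand-u)) cand-u
    loop : ∀ {i} {A : Set} → Adj H i i → A
    loop {i} e = case trans (sym e) (irrefl H i) of λ ()
    g-edge : ∀ {i j} → Adj H i j → Adj G (g i) (g j)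
    g-edge {i} {j} e with ys? i | ys? j
    ... | inj₁ refl         | inj₁ refl               = loop e
    ... | inj₁ refl         | inj₂ (inj₁ refl)        = to-v cand-g-u e
    ... | inj₁ refl         | inj₂ (inj₂ (j∈ , eq))   = Adj-sym G (to-u (cand-f j∈ eq) (Adj-sym H e))
    -- The image of `v` is known as a candidate of level 0 only, so the edge is followed from the
    -- image of `u`.
    ... | inj₂ (inj₁ refl)  | inj₁ refl               = Adj-sym G (to-v cand-g-u (Adj-sym H e))
    ... | inj₂ (inj₁ refl)  | inj₂ (inj₁ refl)        = loop e
    ... | inj₂ (inj₁ refl)  | inj₂ (inj₂ (j∈ , eq))   = Adj-sym G (to-v (cand-f j∈ eq) (Adj-sym H e))
    ... | inj₂ (inj₂ (i∈ , eq)) | inj₁ refl           = to-u (cand-f i∈ eq) e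
    ... | inj₂ (inj₂ (i∈ , eq)) | inj₂ (inj₁ refl)    = to-v (cand-f i∈ eq) e
    ... | inj₂ (inj₂ (i∈ , eq)) | inj₂ (inj₂ (j∈ , eq′)) =
            subst₂ (Adj G) (sym eq) (sym eq′) (edge i∈ j∈ e)

-- The protocol

does⁻ : ∀ {P : Set} (P? : Dec P) → does P? ≡ true → P
does⁻ (yes p) _ = p

∧-true⁻ : ∀ {a b} → a ∧ b ≡ true → a ≡ true × b ≡ true
∧-true⁻ {true} eq = refl , eq

_≟ᵇ_ : ∀ {k} → DecidableEquality (Bits k)
_≟ᵇ_ = Vec.≡-dec Bool._≟_

-- With this encoding of roles, `h` uniform bits serve as a random role for every `h`, power of two
-- or not. Vectors that are not one-hot stand for no role.
oneHot : ∀ {h} → Fin h → Bits h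
oneHot i = Vec.tabulate λ j → does (i Fin.≟ j)

oneHot-injective : ∀ {h} → Injective _≡_ _≡_ (oneHot {h})
oneHot-injective {h} {i} {j} eq = sym (does⁻ (j Fin.≟ i) (begin
  does (j Fin.≟ i)       ≡⟨ Vec.lookup∘tabulate _ i ⟨
  lookup (oneHot j) i    ≡⟨ cong (λ c → lookup c i) eq ⟨
  lookup (oneHot i) i    ≡⟨ Vec.lookup∘tabulate _ i ⟩
  does (i Fin.≟ i)       ≡⟨ dec-true (i Fin.≟ i) refl ⟩
  true                   ∎))
  where open ≡-Reasoning

-- Indexing by natural numbers avoids a bound on the degree in the program of a node. In a network a
-- degree is at most `n`, so the default weight is never read there.
weightAt : ∀ {K n} → Vec (Bits K) n → ℕ → Bits K
weightAt []       _       = Vec.replicate _ false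
weightAt (w ∷ ws) zero    = w
weightAt (w ∷ ws) (suc k) = weightAt ws k

weightAt-toℕ : ∀ {K n} (ws : Vec (Bits K) n) i → weightAt ws (toℕ i) ≡ lookup ws i
weightAt-toℕ (w ∷ ws) zero    = refl
weightAt-toℕ (w ∷ ws) (suc i) = weightAt-toℕ ws i

data Phase : Set where
  draw flood mark prune conclude : Phase

-- b is the length of identifiers, K that of edge weights, and n the number of
-- weights drawn by each node (one per possible port).
module Protocol {h : ℕ} (H : Graph h) (u v : Fin h) (n K b : ℕ) where

  B : ℕ
  B = h + n * K

  -- The weight of an arc and the identifier of its origin. The port can be left out, as the origin
  -- recovers it as its strictly heaviest one.
  Tag : Set
  Tag = Bits K × Bits b

  _≟ᵗ_ : DecidableEquality Tag
  _≟ᵗ_ = Product.≡-dec _≟ᵇ_ _≟ᵇ_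

  ∥_∥ : Tag → ℕ
  ∥ t ∥ = toNat (proj₁ t)

  record Message : Set where
    constructor message
    field
      tag     : Tag
      colour  : Bits h
      flagged : Bool
      alive   : Bool

  record Local (d : ℕ) : Set where
    field
      ident    : Bits b
      blocks   : List (Bits B)
      rejected : Bool
      colour   : Bits h
      weight   : Fin d → Bits K
      tag      : Tag
      alive    : Bool

  open Local

  private
    variable
      d : ℕ

  blockColour : Bits B → Bits h
  blockColour = take h

  blockWeight : Bits B → ℕ → Bits K
  blockWeight β = weightAt (chunk n (drop h β))

  heavier : Tag → Tag → Tag
  heavier t t′ with ∥ t ∥ ℕ.<? ∥ t′ ∥
  ... | yes _ = t′
  ... | no _  = t

  heaviest : Tag → (Fin d → Tag) → Tag
  heaviest {zero}  t c = t
  heaviest {suc d} t c = heaviest (heavier t (c zero)) (c ∘ suc)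

  Origin : Local d → Set
  Origin x = proj₂ (tag x) ≡ ident x

  origin? : (x : Local d) → Dec (Origin x)
  origin? x = proj₂ (tag x) ≟ᵇ ident x

  -- Strictness makes the selected port unique, and with it the image of `v`. On a tie no port is
  -- selected.
  StrictMax : (Fin d → Bits K) → Fin d → Set
  StrictMax w p = ∀ q → q ≢ p → toNat (w q) < toNat (w p)

  strictMax? : (w : Fin d → Bits K) → Decidable (StrictMax w)
  strictMax? w p = Fin.all? λ q → ¬? (q Fin.≟ p) →-dec (toNat (w q) ℕ.<? toNat (w p))

  Selects : Local d → Fin d → Set
  Selects x p = Origin x × StrictMax (weight x) p

  selects? : (x : Local d) → Decidable (Selects x)
  selects? x p = origin? x ×-dec strictMax? (weight x) p

  outgoing : Local d → Fin d → Message
  outgoing x p = message (tag x) (colour x) (does (selects? x p)) (alive x)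

  Targeted : Tag → (Fin d → Message) → Set
  Targeted t m = ∃[ p ] (Message.flagged (m p) ≡ true × Message.tag (m p) ≡ t)

  targeted? : ∀ t (m : Fin d → Message) → Dec (Targeted t m)
  targeted? t m = Fin.any? λ p → (Message.flagged (m p) Bool.≟ true) ×-dec (Message.tag (m p) ≟ᵗ t)

  -- This condition makes the images of `u` and `v` unique among the vertices with one tag:
  -- identifiers are distinct, and an origin flags at most one port. The other roles are free.
  Rooted : Local d → (Fin d → Message) → Set
  Rooted x m = (colour x ≡ oneHot u → Origin x) × (colour x ≡ oneHot v → Targeted (tag x) m)

  rooted? : ∀ (x : Local d) m → Dec (Rooted x m)
  rooted? x m = ((colour x ≟ᵇ oneHot u) →-dec origin? x) ×-dec
                ((colour x ≟ᵇ oneHot v) →-dec targeted? (tag x) m)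

  Supports : Tag → Fin h → Message → Set
  Supports t j m = Message.alive m ≡ true × Message.colour m ≡ oneHot j × Message.tag m ≡ t

  -- Vacuous for a colour that is no role. A vertex with such a colour stays alive under pruning,
  -- but it supports no other vertex and never rejects.
  Supported : Local d → (Fin d → Message) → Set
  Supported x m = ∀ i → colour x ≡ oneHot i → ∀ j → Adj H i j → ∃[ p ] Supports (tag x) j (m p)

  supported? : ∀ (x : Local d) m → Dec (Supported x m)
  supported? x m = Fin.all? λ i → (colour x ≟ᵇ oneHot i) →-dec Fin.all? λ j →
    (adj H i j Bool.≟ true) →-dec Fin.any? λ p →
      (Message.alive (m p) Bool.≟ true) ×-dec (Message.colour (m p) ≟ᵇ oneHot j) ×-dec (Message.tag (m p) ≟ᵗ tag x)

  initial : Bits b → List (Bits B) → Local d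
  initial i βs = record
    { ident = i ; blocks = βs ; rejected = false ; colour = Vec.replicate _ false
    ; weight = λ _ → Vec.replicate _ false ; tag = Vec.replicate _ false , i
    ; alive = false }

  drawFrom : List (Bits B) → Local d → Local d
  -- The tester does not get here: it has one block for each iteration.
  drawFrom     []       x = x
  drawFrom {d} (β ∷ βs) x = record x
    { blocks = βs
    ; colour = blockColour β
    ; weight = λ p → blockWeight β (toℕ p)
    -- The starting weight 0 also serves nodes without ports; it loses against the winning weight of
    -- a good draw, which is positive.
    ; tag    = heaviest {d} (Vec.replicate K false , ident x) (λ p → blockWeight β (toℕ p) , ident x)
    }

  update : Phase → Local d → (Fin d → Message) → Local d
  update draw     x m = drawFrom (blocks x) x
  update flood    x m = record x { tag = heaviest (tag x) (Message.tag ∘ m) }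
  update mark     x m = record x { alive = does (rooted? x m) }
  update prune    x m = record x { alive = alive x ∧ does (supported? x m) }
  update conclude x m = record x { rejected = rejected x ∨ (alive x ∧ does (colour x ≟ᵇ oneHot u)) }

  iteration : ℕ → ℕ → List Phase
  iteration L S = draw ∷ replicate L flood ++ mark ∷ replicate S prune ++ conclude ∷ []

  update-ident : ∀ ϕ (x : Local d) m → ident (update ϕ x m) ≡ ident x
  update-ident draw x m with blocks x
  ... | []    = refl
  ... | _ ∷ _ = refl
  update-ident flood    x m = refl
  update-ident mark     x m = refl
  update-ident prune    x m = refl
  update-ident conclude x m = refl

  update-rejected : ∀ ϕ (x : Local d) m → ϕ ≢ conclude → rejected (update ϕ x m) ≡ rejected x
  update-rejected draw x m ϕ≢ with blocks x
  ... | []    = refl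
  ... | _ ∷ _ = refl
  update-rejected flood    x m ϕ≢ = refl
  update-rejected mark     x m ϕ≢ = refl
  update-rejected prune    x m ϕ≢ = refl
  update-rejected conclude x m ϕ≢ = contradiction refl ϕ≢

  update-stays-rejected : ∀ ϕ (x : Local d) m → rejected x ≡ true → rejected (update ϕ x m) ≡ true
  update-stays-rejected draw     x m r = trans (update-rejected draw x m λ ()) r
  update-stays-rejected flood    x m r = r
  update-stays-rejected mark     x m r = r
  update-stays-rejected prune    x m r = r
  update-stays-rejected conclude x m r = cong (_∨ _) r

  update-blocks : ∀ ϕ (x : Local d) m → ϕ ≢ draw → blocks (update ϕ x m) ≡ blocks x
  update-blocks draw     x m ϕ≢ = contradiction refl ϕ≢
  update-blocks flood    x m ϕ≢ = refl
  update-blocks mark     x m ϕ≢ = refl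
  update-blocks prune    x m ϕ≢ = refl
  update-blocks conclude x m ϕ≢ = refl

  -- A tag beats another one only if its weight is strictly larger, so τ wins
  -- against tags of smaller weight.
  module _ (τ : Tag) where

    Dominated : Tag → Set
    Dominated t = t ≡ τ ⊎ ∥ t ∥ < ∥ τ ∥

    heavier-dominated : ∀ {t t′} → Dominated t → Dominated t′ → Dominated (heavier t t′)
    heavier-dominated {t} {t′} D D′ with ∥ t ∥ ℕ.<? ∥ t′ ∥
    ... | yes _ = D′
    ... | no _  = D

    heavier-τˡ : ∀ {t′} → Dominated t′ → heavier τ t′ ≡ τ
    heavier-τˡ {t′} D′ with ∥ τ ∥ ℕ.<? ∥ t′ ∥ | D′
    ... | no _  | _         = refl
    ... | yes _ | inj₁ t′≡τ = t′≡τ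
    ... | yes p | inj₂ q    = contradiction q (<-asym p)

    heavier-τʳ : ∀ {t} → Dominated t → heavier t τ ≡ τ
    heavier-τʳ {t} D with ∥ t ∥ ℕ.<? ∥ τ ∥ | D
    ... | yes _ | _        = refl
    ... | no _  | inj₁ t≡τ = t≡τ
    ... | no ¬p | inj₂ q   = contradiction q ¬p

    heaviest-dominated : ∀ {d t} {c : Fin d → Tag} → Dominated t → (∀ p → Dominated (c p)) →
                         Dominated (heaviest t c)
    heaviest-dominated {zero}  D Dc = D
    heaviest-dominated {suc d} D Dc = heaviest-dominated (heavier-dominated D (Dc zero)) (Dc ∘ suc)

    heaviest-start : ∀ {d t} {c : Fin d → Tag} → t ≡ τ → (∀ p → Dominated (c p)) → heaviest t c ≡ τ
    heaviest-start {zero}  refl Dc = refl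
    heaviest-start {suc d} refl Dc = heaviest-start (heavier-τˡ (Dc zero)) (Dc ∘ suc)

    heaviest-found : ∀ {d t} {c : Fin d → Tag} → Dominated t → (∀ p → Dominated (c p)) →
                     ∀ p → c p ≡ τ → heaviest t c ≡ τ
    heaviest-found {t = t} D Dc zero eq =
      heaviest-start (trans (cong (heavier t) eq) (heavier-τʳ D)) (Dc ∘ suc)
    heaviest-found D Dc (suc p) eq = heaviest-found (heavier-dominated D (Dc zero)) (Dc ∘ suc) p eq

  -- Executions of the whole network as runs of phases

  module Global {G : Graph n} (N : Network G b) where

    open Network N hiding (ident)

    Config : Set
    Config = ∀ x → Local (deg x)

    -- The received messages are known only up to pointwise equality, since
    -- function extensionality is not available.
    record Step (ϕ : Phase) (c c′ : Config) : Set where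
      field
        stepAt : ∀ x → ∃[ m ] ((∀ p → m p ≡ outgoing (c (nbr x p)) (backPort x p)) × c′ x ≡ update ϕ (c x) m)

    open Step

    data Run : List Phase → Config → Config → Set where
      []  : ∀ {c} → Run [] c c
      _∷_ : ∀ {ϕ ϕs c c₁ c′} → Step ϕ c c₁ → Run ϕs c₁ c′ → Run (ϕ ∷ ϕs) c c′

    run-++ : ∀ ϕs {ϕs′ c c′} → Run (ϕs ++ ϕs′) c c′ → ∃[ c₁ ] (Run ϕs c c₁ × Run ϕs′ c₁ c′)
    run-++ []       r       = _ , [] , r
    run-++ (ϕ ∷ ϕs) (s ∷ r) = let c₁ , r₁ , r₂ = run-++ ϕs r in c₁ , s ∷ r₁ , r₂

    -- The index of the invariant counts rounds: it is the radius in `Flooded` and the level in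
    -- `Sifted`.
    run-replicate : ∀ {ϕ} (I : ℕ → Config → Set) → (∀ {s c c′} → Step ϕ c c′ → I s c → I (suc s) c′) →
                    ∀ k {s c c′} → Run (replicate k ϕ) c c′ → I s c → I (k + s) c′
    run-replicate I step zero    []       i = i
    run-replicate I step (suc k) {s} {c′ = c′} (st ∷ r) i =
      subst (λ t → I t c′) (+-suc k s) (run-replicate I step k r (step st i))

    run-all : (I : Config → Set) → (∀ {ϕ c c′} → Step ϕ c c′ → I c → I c′) →
              ∀ ϕs {c c′} → Run ϕs c c′ → I c → I c′
    run-all I step []       []       i = i
    run-all I step (ϕ ∷ ϕs) (st ∷ r) i = run-all I step ϕs r (step st i)

    record IterationRun (L S : ℕ) (c c′ : Config) : Set where
      field
        {drawn flooded marked pruned} : Config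
        drawing    : Step draw c drawn
        flooding   : Run (replicate L flood) drawn flooded
        marking    : Step mark flooded marked
        pruning    : Run (replicate S prune) marked pruned
        concluding : Step conclude pruned c′

    iterationRun : ∀ L S {c c′} → Run (iteration L S) c c′ → IterationRun L S c c′
    iterationRun L S (drawing ∷ r) with run-++ (replicate L flood) r
    ... | _ , flooding , marking ∷ r′ with run-++ (replicate S prune) r′
    ... | _ , pruning , concluding ∷ [] = record
      { drawing = drawing ; flooding = flooding ; marking = marking ; pruning = pruning ; concluding = concluding }

    Identified : Config → Set
    Identified c = ∀ x → ident (c x) ≡ Network.ident N x

    identified-step : ∀ {ϕ c c′} → Step ϕ c c′ → Identified c → Identified c′
    identified-step {ϕ} {c} st i x with stepAt st x
    ... | m , _ , eq = trans (cong ident eq) (trans (update-ident ϕ (c x) m) (i x))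

    Unrejected : Config → Set
    Unrejected c = ∀ x → rejected (c x) ≡ false

    unrejected-step : ∀ {ϕ c c′} → ϕ ≢ conclude → Step ϕ c c′ → Unrejected c → Unrejected c′
    unrejected-step {ϕ} {c} ϕ≢ st i x with stepAt st x
    ... | m , _ , eq = trans (cong rejected eq) (trans (update-rejected ϕ (c x) m ϕ≢) (i x))

    -- Soundness

    module Sound {L : ℕ} (within : ∀ i → Within H u L i) {ys} (order : EliminationOrder H ys)
                 (covers : ∀ {i} → i ≢ u → i ≢ v → i ∈ ys) (uv : Adj H u v) where

      S : ℕ
      S = length ys + (L + 1)

      module _ (c : Config) where

        Base : Fin n → Set
        Base x = (colour (c x) ≡ oneHot u → Origin (c x)) ×
                 (colour (c x) ≡ oneHot v →
                  ∃[ y ] ∃[ p ] (nbr y p ≡ x × tag (c y) ≡ tag (c x) × Selects (c y) p))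

        -- Pruning in terms of the configuration `c` before marking. Within the iteration colours
        -- and tags are frozen from then on, so surviving `s` rounds is a property of `c` alone.
        Survives : ℕ → Fin n → Set
        Survives zero    x = Base x
        Survives (suc s) x = Survives s x ×
          (∀ i → colour (c x) ≡ oneHot i → ∀ j → Adj H i j → ∃[ p ]
            (Survives s (nbr x p) × colour (c (nbr x p)) ≡ oneHot j × tag (c (nbr x p)) ≡ tag (c x)))

        record Sifted (s : ℕ) (c′ : Config) : Set where
          field
            survives : ∀ x → alive (c′ x) ≡ true → Survives s x
            colour≡  : ∀ x → colour (c′ x) ≡ colour (c x)
            tag≡     : ∀ x → tag (c′ x) ≡ tag (c x)

        open Sifted

        sifted-mark : ∀ {c′} → Step mark c c′ → Sifted 0 c′
        sifted-mark {c′} st = record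
          { survives = survives′
          ; colour≡  = λ x → cong colour (proj₂ (proj₂ (stepAt st x)))
          ; tag≡     = λ x → cong tag (proj₂ (proj₂ (stepAt st x)))
          }
          where
          survives′ : ∀ x → alive (c′ x) ≡ true → Base x
          survives′ x live with stepAt st x
          ... | m , m≡ , eq with does⁻ (rooted? (c x) m) (trans (sym (cong alive eq)) live)
          ... | atU , atV = atU , λ isV →
            let q , fl , tg = atV isV
                fl′ = trans (sym (cong Message.flagged (m≡ q))) fl
            in nbr x q , backPort x q , nbr-port (nbr x q) x _ ,
               trans (sym (cong Message.tag (m≡ q))) tg ,
               does⁻ (selects? (c (nbr x q)) (backPort x q)) fl′

        sifted-prune : ∀ {s c₁ c₂} → Step prune c₁ c₂ → Sifted s c₁ → Sifted (suc s) c₂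
        sifted-prune {s} {c₁} {c₂} st I = record
          { survives = survives′
          ; colour≡  = λ x → trans (cong colour (proj₂ (proj₂ (stepAt st x)))) (colour≡ I x)
          ; tag≡     = λ x → trans (cong tag (proj₂ (proj₂ (stepAt st x)))) (tag≡ I x)
          }
          where
          survives′ : ∀ x → alive (c₂ x) ≡ true → Survives (suc s) x
          survives′ x live with stepAt st x
          ... | m , m≡ , eq with ∧-true⁻ (trans (sym (cong alive eq)) live)
          ... | live₁ , sup = survives I x live₁ , λ i isI j ij →
            let p , al , co , tg = does⁻ (supported? (c₁ x) m) sup i (trans (colour≡ I x) isI) j ij
            in p ,
               survives I (nbr x p) (trans (sym (cong Message.alive (m≡ p))) al) ,
               trans (sym (colour≡ I (nbr x p))) (trans (sym (cong Message.colour (m≡ p))) co) ,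
               trans (sym (tag≡ I (nbr x p))) (trans (sym (cong Message.tag (m≡ p))) (trans tg (tag≡ I x)))

        survives-base : ∀ s {x} → Survives s x → Base x
        survives-base zero    b       = b
        survives-base (suc s) (b , _) = survives-base s b

        -- The candidates are the survivors that share the tag of `x`, and their level is the number
        -- of rounds survived. Keeping to one tag makes the images of `u` and `v` unique.
        survivor⇒contains : Identified c → ∀ {x} → Survives S x → colour (c x) ≡ oneHot u → Contains G H
        survivor⇒contains ids {x} survivor isU =
          candidate⇒contains H G uv Candidate
            (λ {s} {i} {y} → weaken {s} {i} {y}) (λ {s} {i} {j} {y} → extend {s} {i} {j} {y}) disjoint unique-u unique-v
            within order covers (survivor , isU , refl)
          where
          Candidate : ℕ → Fin h → Fin n → Set
          Candidate s i y = Survives s y × colour (c y) ≡ oneHot i × tag (c y) ≡ tag (c x)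
          weaken : ∀ {s i y} → Candidate (suc s) i y → Candidate s i y
          weaken ((sv , _) , co , tg) = sv , co , tg
          extend : ∀ {s i j y} → Candidate (suc s) i y → Adj H i j → ∃[ z ] (Adj G y z × Candidate s j z)
          extend {y = y} ((_ , sup) , co , tg) ij =
            let p , sv , co′ , tg′ = sup _ co _ ij
            in nbr y p , nbr-adj y p , sv , co′ , trans tg′ tg
          disjoint : ∀ {i j y} → Candidate 0 i y → Candidate 0 j y → i ≡ j
          disjoint (_ , co , _) (_ , co′ , _) = oneHot-injective (trans (sym co) co′)
          origin-unique : ∀ {y z} → Origin (c y) → Origin (c z) → tag (c y) ≡ tag (c z) → y ≡ z
          origin-unique {y} {z} oy oz eq = ident-injective (begin
            Network.ident N y   ≡⟨ ids y ⟨
            ident (c y)         ≡⟨ oy ⟨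
            proj₂ (tag (c y))   ≡⟨ cong proj₂ eq ⟩
            proj₂ (tag (c z))   ≡⟨ oz ⟩
            ident (c z)         ≡⟨ ids z ⟩
            Network.ident N z   ∎)
            where open ≡-Reasoning
          unique-u : ∀ {y z} → Candidate 0 u y → Candidate 0 u z → y ≡ z
          unique-u ((oy , _) , co , tg) ((oz , _) , co′ , tg′) =
            origin-unique (oy co) (oz co′) (trans tg (sym tg′))
          max-unique : ∀ {d} {w : Fin d → Bits K} {p q} → StrictMax w p → StrictMax w q → p ≡ q
          max-unique {p = p} {q} mp mq = decidable-stable (p Fin.≟ q) λ p≢q →
            <-asym (mp q (p≢q ∘ sym)) (mq p p≢q)
          -- Both vertices were flagged by origins of the same tag. These origins are one vertex,
          -- which has only one strictly heaviest port.
          unique-v : ∀ {y z} → Candidate 0 v y → Candidate 0 v z → y ≡ z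
          unique-v ((_ , ty) , co , tg) ((_ , tz) , co′ , tg′) with ty co | tz co′
          ... | a , p , refl , ta , oa , mp | a′ , p′ , refl , ta′ , oa′ , mp′
            with origin-unique {a} {a′} oa oa′ (trans ta (trans tg (sym (trans ta′ tg′))))
          ... | refl = cong (nbr a) (max-unique {w = weight (c a)} mp mp′)

      sound : ∀ {c c′} → Free H G → Run (iteration L S) c c′ →
              Identified c → Unrejected c → Unrejected c′
      sound {c} {c′} free r ids un x with stepAt concluding x
        where open IterationRun (iterationRun L S r)
      ... | m , _ , eq = trans (cong rejected eq) (cong₂ _∨_ (un₄ x) verdict)
        where
        open IterationRun (iterationRun L S r)
        ids₂ : Identified flooded
        ids₂ = run-all Identified identified-step (replicate L flood) flooding (identified-step drawing ids)
        un₂ : Unrejected flooded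
        un₂ = run-replicate (λ _ → Unrejected) (unrejected-step λ ()) L {s = 0} flooding
                (unrejected-step (λ ()) drawing un)
        un₄ : Unrejected pruned
        un₄ = run-replicate (λ _ → Unrejected) (unrejected-step λ ()) S {s = 0} pruning
                (unrejected-step (λ ()) marking un₂)
        sifted : Sifted flooded (S + 0) pruned
        sifted = run-replicate (Sifted flooded) (sifted-prune flooded) S pruning (sifted-mark flooded marking)
        verdict : alive (pruned x) ∧ does (colour (pruned x) ≟ᵇ oneHot u) ≡ false
        verdict with alive (pruned x) in live | colour (pruned x) ≟ᵇ oneHot u
        ... | false | _       = refl
        ... | true  | no _    = refl
        ... | true  | yes isU = contradiction
          (survivor⇒contains flooded ids₂
            (subst (λ s → Survives flooded s x) (+-identityʳ S) (Sifted.survives sifted x live))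
            (trans (sym (Sifted.colour≡ sifted x)) isU))
          free

    -- Completeness

    module Complete {L : ℕ} (within : ∀ i → Within H u L i) (uv : Adj H u v)
                    (f : Fin h → Fin n) (f-adj : ∀ i j → Adj H i j → Adj G (f i) (f j)) where

      SelectedArc : ∀ x → Fin (deg x) → Set
      SelectedArc x p = x ≡ f u × nbr x p ≡ f v

      -- The arc from `f u` to `f v` beats every other arc of the network, its own reverse included.
      -- Fixing its weight `w` splits the good draws into classes that are counted separately.
      record GoodDraw (w : ℕ) (β : Fin n → Bits B) : Set where
        field
          coloured : ∀ i → blockColour (β (f i)) ≡ oneHot i
          selected : ∀ x p → SelectedArc x p → toNat (blockWeight (β x) (toℕ p)) ≡ w
          lighter  : ∀ x p → ¬ SelectedArc x p → toNat (blockWeight (β x) (toℕ p)) < w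

      module _ {w : ℕ} {β : Fin n → Bits B} (good : GoodDraw w β) where

        open GoodDraw good

        portTo : ∀ i j → Adj H i j → Fin (deg (f i))
        portTo i j ij = port (f i) (f j) (f-adj i j ij)

        τ : Tag
        τ = blockWeight (β (f u)) (toℕ (portTo u v uv)) , Network.ident N (f u)

        ∥τ∥≡w : ∥ τ ∥ ≡ w
        ∥τ∥≡w = selected (f u) (portTo u v uv) (refl , nbr-port _ _ _)

        -- The reverse arc is strictly lighter. Positivity keeps the initial tags of weight 0 below
        -- `τ`.
        0<w : 0 < w
        0<w = ≤-<-trans z≤n (lighter (f v) (portTo v u (Adj-sym H uv)) λ (fv≡fu , _) →
          case trans (sym (f-adj u v uv)) (trans (cong (adj G (f u)) fv≡fu) (irrefl G (f u))) of λ ())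

        -- `τ` travels along the images of walks in `H`, one hop per round, and `dominated` ensures
        -- that nothing sent by the rest of the network displaces it.
        record Flooded (k : ℕ) (c : Config) : Set where
          field
            identified : Identified c
            dominated  : ∀ x → Dominated τ (tag (c x))
            reached    : ∀ i → Within H u k i → tag (c (f i)) ≡ τ
            colours    : ∀ i → colour (c (f i)) ≡ oneHot i
            weights    : ∀ x → weight (c x) ≡ λ p → blockWeight (β x) (toℕ p)

        open Flooded

        flooded-draw : ∀ {c c′} → Step draw c c′ → Identified c →
                       (∀ x → ∃[ βs ] blocks (c x) ≡ β x ∷ βs) → Flooded 0 c′
        flooded-draw {c} {c′} st ids bl = record
          { identified = identified-step st ids
          ; dominated  = λ x → subst (Dominated τ) (sym (tag′ x))
                           (heaviest-dominated τ (zero-dominated x) (candidate-dominated x))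
          ; reached    = λ { i source → trans (tag′ (f u))
                           (heaviest-found τ (zero-dominated (f u)) (candidate-dominated (f u))
                              (portTo u v uv) (cong (_ ,_) (ids (f u)))) }
          ; colours    = λ i → trans (cong colour (drawn (f i))) (coloured i)
          ; weights    = λ x → cong weight (drawn x)
          }
          where
          drawn : ∀ x → c′ x ≡ drawFrom (β x ∷ proj₁ (bl x)) (c x)
          drawn x = trans (proj₂ (proj₂ (stepAt st x))) (cong (λ βs → drawFrom βs (c x)) (proj₂ (bl x)))
          tag′ : ∀ x → tag (c′ x) ≡ heaviest {deg x} (Vec.replicate K false , ident (c x))
                                              (λ p → blockWeight (β x) (toℕ p) , ident (c x))
          tag′ x = cong tag (drawn x)
          zero-dominated : ∀ x → Dominated τ (Vec.replicate K false , ident (c x))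
          zero-dominated x = inj₂ (subst₂ _<_ (sym (toNat-zeros K)) (sym ∥τ∥≡w) 0<w)
          candidate-dominated : ∀ x p → Dominated τ (blockWeight (β x) (toℕ p) , ident (c x))
          candidate-dominated x p with x Fin.≟ f u | nbr x p Fin.≟ f v
          -- Ports of one vertex towards the same neighbour coincide, so this is the port whose
          -- weight defines `τ`.
          ... | yes refl | yes eq = inj₁ (cong₂ (λ q i → blockWeight (β (f u)) (toℕ q) , i)
                  (nbr-injective (f u) (trans eq (sym (nbr-port _ _ _)))) (ids (f u)))
          ... | no x≢a   | _      = inj₂ (subst (_ <_) (sym ∥τ∥≡w) (lighter x p (x≢a ∘ proj₁)))
          ... | yes _    | no y≢b = inj₂ (subst (_ <_) (sym ∥τ∥≡w) (lighter x p (y≢b ∘ proj₂)))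

        flooded-flood : ∀ {k c c′} → Step flood c c′ → Flooded k c → Flooded (suc k) c′
        flooded-flood {k} {c} {c′} st I = record
          { identified = identified-step st (identified I)
          ; dominated  = λ x → subst (Dominated τ) (sym (tag′ x)) (heaviest-dominated τ (dominated I x) (received x))
          ; reached    = reached′
          ; colours    = λ i → trans (cong colour (proj₂ (proj₂ (stepAt st (f i))))) (colours I i)
          ; weights    = λ x → trans (cong weight (proj₂ (proj₂ (stepAt st x)))) (weights I x)
          }
          where
          m : ∀ x → Fin (deg x) → Message
          m x = proj₁ (stepAt st x)
          m≡ : ∀ x p → Message.tag (m x p) ≡ tag (c (nbr x p))
          m≡ x p = cong Message.tag (proj₁ (proj₂ (stepAt st x)) p)
          tag′ : ∀ x → tag (c′ x) ≡ heaviest (tag (c x)) (Message.tag ∘ m x)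
          tag′ x = cong tag (proj₂ (proj₂ (stepAt st x)))
          received : ∀ x p → Dominated τ (Message.tag (m x p))
          received x p = subst (Dominated τ) (sym (m≡ x p)) (dominated I (nbr x p))
          reached′ : ∀ i → Within H u (suc k) i → tag (c′ (f i)) ≡ τ
          reached′ _ source = trans (tag′ (f u)) (heaviest-start τ (reached I u source) (received (f u)))
          reached′ j (hop {i = i} wi ij) = trans (tag′ (f j))
            (heaviest-found τ (dominated I (f j)) (received (f j)) (portTo j i (Adj-sym H ij))
              (trans (m≡ _ _) (trans (cong (tag ∘ c) (nbr-port _ _ _)) (reached I i wi))))

        record Live (c : Config) : Set where
          field
            tags      : ∀ i → tag (c (f i)) ≡ τ
            colours   : ∀ i → colour (c (f i)) ≡ oneHot i
            all-alive : ∀ i → alive (c (f i)) ≡ true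

        live-mark : ∀ {c c′} → Step mark c c′ → Flooded L c → Live c′
        live-mark {c} {c′} st I = record
          { tags      = λ i → trans (cong tag (proj₂ (proj₂ (stepAt st (f i))))) (reached I i (within i))
          ; colours   = λ i → trans (cong colour (proj₂ (proj₂ (stepAt st (f i))))) (colours I i)
          ; all-alive = λ i → trans (cong alive (proj₂ (proj₂ (stepAt st (f i))))) (dec-true (rooted? (c (f i)) (proj₁ (stepAt st (f i)))) (atU i , atV i))
          }
          where
          tags : ∀ i → tag (c (f i)) ≡ τ
          tags i = reached I i (within i)
          role : ∀ {i j} → colour (c (f i)) ≡ oneHot j → i ≡ j
          role {i} eq = oneHot-injective (trans (sym (colours I i)) eq)
          originU : Origin (c (f u))
          originU = trans (cong proj₂ (tags u)) (sym (identified I (f u)))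
          atU : ∀ i → colour (c (f i)) ≡ oneHot u → Origin (c (f i))
          atU i eq with role {i} {u} eq
          ... | refl = originU
          -- The other end of the port of f v towards f u is only
          -- propositionally f u, hence the generality in y.
          selectsU : ∀ y (p : Fin (deg y)) → y ≡ f u → nbr y p ≡ f v → Selects (c y) p
          selectsU y p refl eq = originU , λ q q≢p →
            subst₂ _<_ (sym (cong (λ wt → toNat (wt q)) (weights I (f u))))
                       (sym (cong (λ wt → toNat (wt p)) (weights I (f u))))
              (<-≤-trans (lighter (f u) q (λ (_ , eq′) → q≢p (nbr-injective (f u) (trans eq′ (sym eq)))))
                         (≤-reflexive (sym (selected (f u) p (refl , eq)))))
          atV : ∀ i → colour (c (f i)) ≡ oneHot v → Targeted (tag (c (f i))) (proj₁ (stepAt st (f i)))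
          atV i eq with role {i} {v} eq
          ... | refl = q ,
              trans (cong Message.flagged (m≡ q))
                (dec-true (selects? (c (nbr (f v) q)) (backPort (f v) q)) (selectsU (nbr (f v) q) (backPort (f v) q) back (nbr-port _ _ _))) ,
              trans (cong Message.tag (m≡ q)) (trans (cong (tag ∘ c) back) (trans (tags u) (sym (tags v))))
            where
            q : Fin (deg (f v))
            q = portTo v u (Adj-sym H uv)
            m≡ = proj₁ (proj₂ (stepAt st (f v)))
            back : nbr (f v) q ≡ f u
            back = nbr-port _ _ _

        -- The copy supports itself: each adjacent role is played by the image of a neighbour, which
        -- is alive and has the tag `τ` as well.
        live-prune : ∀ {c c′} → Step prune c c′ → Live c → Live c′
        live-prune {c} {c′} st I = record
          { tags      = λ i → trans (cong tag (proj₂ (proj₂ (stepAt st (f i))))) (Live.tags I i)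
          ; colours   = λ i → trans (cong colour (proj₂ (proj₂ (stepAt st (f i))))) (Live.colours I i)
          ; all-alive = λ i → trans (cong alive (proj₂ (proj₂ (stepAt st (f i)))))
                                (cong₂ _∧_ (Live.all-alive I i) (dec-true (supported? (c (f i)) (proj₁ (stepAt st (f i)))) (supported i)))
          }
          where
          supported : ∀ i → Supported (c (f i)) (proj₁ (stepAt st (f i)))
          supported i i′ eq j i′j with oneHot-injective {x = i} {y = i′} (trans (sym (Live.colours I i)) eq)
          ... | refl = q ,
              trans (cong Message.alive (m≡ q)) (trans (cong (alive ∘ c) at-j) (Live.all-alive I j)) ,
              trans (cong Message.colour (m≡ q)) (trans (cong (colour ∘ c) at-j) (Live.colours I j)) ,
              trans (cong Message.tag (m≡ q)) (trans (cong (tag ∘ c) at-j) (trans (Live.tags I j) (sym (Live.tags I i))))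
            where
            q : Fin (deg (f i))
            q = portTo i j i′j
            m≡ = proj₁ (proj₂ (stepAt st (f i)))
            at-j : nbr (f i) q ≡ f j
            at-j = nbr-port _ _ _

        complete : ∀ {S c c′} → Run (iteration L S) c c′ → Identified c →
                   (∀ x → ∃[ βs ] blocks (c x) ≡ β x ∷ βs) → rejected (c′ (f u)) ≡ true
        complete {S} r ids bl with stepAt concluding (f u)
          where open IterationRun (iterationRun L S r)
        ... | m , _ , eq = trans (cong rejected eq)
            (trans (cong (rejected (pruned (f u)) ∨_)
                     (cong₂ _∧_ (Live.all-alive live u) (dec-true (_ ≟ᵇ oneHot u) (Live.colours live u))))
                   (Bool.∨-zeroʳ (rejected (pruned (f u)))))
          where
          open IterationRun (iterationRun L S r)
          live : Live pruned
          live = run-replicate (λ _ → Live) live-prune S {s = 0} pruning (live-mark marking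
            (subst (λ k → Flooded k flooded) (+-identityʳ L)
              (run-replicate Flooded flooded-flood L flooding (flooded-draw drawing ids bl))))

    -- Repetition

    run-stays-rejected : ∀ ϕs {c c′} → Run ϕs c c′ → ∀ x → rejected (c x) ≡ true → rejected (c′ x) ≡ true
    run-stays-rejected ϕs r x = run-all (λ c → rejected (c x) ≡ true) step ϕs r
      where
      step : ∀ {ϕ c c′} → Step ϕ c c′ → rejected (c x) ≡ true → rejected (c′ x) ≡ true
      step {ϕ} {c} st rej with stepAt st x
      ... | m , _ , eq = trans (cong rejected eq) (update-stays-rejected ϕ (c x) m rej)

    run-blocks : ∀ L S {c c′} → Run (iteration L S) c c′ →
                 ∀ x {β βs} → blocks (c x) ≡ β ∷ βs → blocks (c′ x) ≡ βs
    run-blocks L S {c} {c′} r x {β} {βs} eq =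
      keep (λ ()) concluding
        (run-replicate (λ _ → Remaining) (keep λ ()) S {s = 0} pruning
          (keep (λ ()) marking
            (run-replicate (λ _ → Remaining) (keep λ ()) L {s = 0} flooding after-draw)))
      where
      open IterationRun (iterationRun L S r)
      Remaining : Config → Set
      Remaining c = blocks (c x) ≡ βs
      keep : ∀ {ϕ c c′} → ϕ ≢ draw → Step ϕ c c′ → Remaining c → Remaining c′
      keep {ϕ} {c} ϕ≢ st rem with stepAt st x
      ... | m , _ , eq = trans (cong blocks eq) (trans (update-blocks ϕ (c x) m ϕ≢) rem)
      after-draw : Remaining drawn
      after-draw with stepAt drawing x
      ... | m , _ , eq′ = trans (cong blocks eq′) (cong (λ bs → blocks (drawFrom bs (c x))) eq)

-- Message encoding

resize : ∀ {m} n → Bits m → Bits n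
resize zero    xs       = []
resize (suc n) []       = false ∷ resize n []
resize (suc n) (x ∷ xs) = x ∷ resize n xs

resize-resize : ∀ {m n} → m ≤ n → (xs : Bits m) → resize m (resize n xs) ≡ xs
resize-resize z≤n       []       = refl
resize-resize (s≤s m≤n) (x ∷ xs) = cong (x ∷_) (resize-resize m≤n xs)

take-++ : ∀ {A : Set} {m n} (xs : Vec A m) (ys : Vec A n) → take m (xs Vec.++ ys) ≡ xs
take-++ []       ys = refl
take-++ (x ∷ xs) ys = cong (x ∷_) (take-++ xs ys)

drop-++ : ∀ {A : Set} {m n} (xs : Vec A m) (ys : Vec A n) → drop m (xs Vec.++ ys) ≡ ys
drop-++ []       ys = refl
drop-++ (x ∷ xs) ys = drop-++ xs ys

-- Induction by halving: passing from n to ⌈n/2⌉ lowers the logarithm by one.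
log₂≤⇒≤2^ : ∀ k n → ⌈log₂ n ⌉ ≤ k → n ≤ 2 ^ k
log₂≤⇒≤2^ zero    zero          _ = z≤n
log₂≤⇒≤2^ zero    (suc zero)    _ = ≤-refl
log₂≤⇒≤2^ zero    n@(suc (suc _)) log≤0 = contradiction
  (≤-trans (≤-reflexive (sym (⌈log₂2^n⌉≡n 1))) (≤-trans (⌈log₂⌉-mono-≤ {2} {n} (s≤s (s≤s z≤n))) log≤0)) λ ()
log₂≤⇒≤2^ (suc k) n log≤ = begin
  n                              ≡⟨ ⌊n/2⌋+⌈n/2⌉≡n n ⟨
  ℕ.⌊ n /2⌋ + ℕ.⌈ n /2⌉          ≤⟨ +-mono-≤ (≤-trans (⌊n/2⌋≤⌈n/2⌉ n) half≤) half≤ ⟩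
  2 ^ k + 2 ^ k                  ≡⟨ cong (2 ^ k +_) (+-identityʳ (2 ^ k)) ⟨
  2 ^ suc k                      ∎
  where
  open ≤-Reasoning
  half≤ : ℕ.⌈ n /2⌉ ≤ 2 ^ k
  half≤ = log₂≤⇒≤2^ k ℕ.⌈ n /2⌉ (≤-trans (≤-reflexive (⌈log₂⌈n/2⌉⌉≡⌈log₂n⌉∸1 n)) (∸-monoˡ-≤ 1 log≤))

n≤2^⌈log₂n⌉ : ∀ n → n ≤ 2 ^ ⌈log₂ n ⌉
n≤2^⌈log₂n⌉ n = log₂≤⇒≤2^ ⌈log₂ n ⌉ n ≤-refl

0<⌈log₂n⌉ : ∀ {n} (G : Graph n) {x y} → Adj G x y → 0 < ⌈log₂ n ⌉
0<⌈log₂n⌉ {suc zero} G {zero} {zero} xx = case trans (sym xx) (irrefl G zero) of λ ()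
0<⌈log₂n⌉ {n@(suc (suc _))} G _ =
  ≤-trans (≤-reflexive (sym (⌈log₂2^n⌉≡n 1))) (⌈log₂⌉-mono-≤ {2} {n} (s≤s (s≤s z≤n)))

-- The algorithm

module Tester {h : ℕ} (H : Graph h) (u v : Fin h) (a n L S T : ℕ) where

  ℓ : ℕ
  ℓ = ⌈log₂ n ⌉

  open Protocol H u v n (3 * ℓ) (a * ℓ) public
  open Local

  width : ℕ
  width = 3 * ℓ + (a * ℓ + (h + 2))

  factor : ℕ
  factor = 3 + (a + (h + 2))

  -- The colour and the two flags take `h + 2` bits, which `(h + 2) * ℓ` covers once ℓ is positive.
  -- If ℓ is zero, there is at most one vertex and no message is sent.
  width≤ : 0 < ℓ → width ≤ factor * ℓ
  width≤ 0<ℓ = begin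
    3 * ℓ + (a * ℓ + (h + 2))          ≡⟨ cong (λ k → 3 * ℓ + (a * ℓ + k)) (*-identityʳ (h + 2)) ⟨
    3 * ℓ + (a * ℓ + (h + 2) * 1)      ≤⟨ +-monoʳ-≤ (3 * ℓ) (+-monoʳ-≤ (a * ℓ) (*-monoʳ-≤ (h + 2) 0<ℓ)) ⟩
    3 * ℓ + (a * ℓ + (h + 2) * ℓ)      ≡⟨ collect ℓ a (h + 2) ⟩
    factor * ℓ                         ∎
    where
    open ≤-Reasoning
    collect : ∀ ℓ a k → 3 * ℓ + (a * ℓ + k * ℓ) ≡ (3 + (a + k)) * ℓ
    collect = solve-∀

  toBits : Message → Bits width
  toBits (message (w , i) co fl al) = w Vec.++ (i Vec.++ (co Vec.++ (fl ∷ al ∷ [])))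

  flags : Bits 2 → Bits (3 * ℓ) → Bits (a * ℓ) → Bits h → Message
  flags (fl ∷ al ∷ []) w i co = message (w , i) co fl al

  fromBits : Bits width → Message
  fromBits bs =
    let bs₁ = drop (3 * ℓ) bs
        bs₂ = drop (a * ℓ) bs₁
    in flags (drop h bs₂) (take (3 * ℓ) bs) (take (a * ℓ) bs₁) (take h bs₂)

  fromBits-toBits : ∀ m → fromBits (toBits m) ≡ m
  fromBits-toBits (message (w , i) co fl al)
    rewrite take-++ w (i Vec.++ (co Vec.++ (fl ∷ al ∷ []))) | drop-++ w (i Vec.++ (co Vec.++ (fl ∷ al ∷ [])))
          | take-++ i (co Vec.++ (fl ∷ al ∷ [])) | drop-++ i (co Vec.++ (fl ∷ al ∷ []))
          | take-++ co (fl ∷ al ∷ []) | drop-++ co (fl ∷ al ∷ [])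
    = refl

  encode : Message → Bits (factor * ℓ)
  encode m = resize (factor * ℓ) (toBits m)

  decode : Bits (factor * ℓ) → Message
  decode bs = fromBits (resize width bs)

  decode-encode : 0 < ℓ → ∀ m → decode (encode m) ≡ m
  decode-encode 0<ℓ m = trans (cong fromBits (resize-resize (width≤ 0<ℓ) (toBits m))) (fromBits-toBits m)

  repeated : ℕ → List Phase
  repeated zero    = []
  repeated (suc t) = iteration L S ++ repeated t

  length-repeated : ∀ t → length (repeated t) ≡ t * (L + S + 3)
  length-repeated zero    = refl
  length-repeated (suc t) = begin
    length (iteration L S ++ repeated t)
      ≡⟨ List.length-++ (iteration L S) ⟩
    length (iteration L S) + length (repeated t)
      ≡⟨ cong₂ _+_ length-iteration (length-repeated t) ⟩
    (L + S + 3) + t * (L + S + 3) ∎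
    where
    open ≡-Reasoning
    reorder : ∀ L S → suc (L + suc (S + 1)) ≡ L + S + 3
    reorder = solve-∀
    length-iteration : length (iteration L S) ≡ L + S + 3
    length-iteration = begin
      suc (length (replicate L flood ++ mark ∷ replicate S prune ++ conclude ∷ []))
        ≡⟨ cong suc (List.length-++ (replicate L flood)) ⟩
      suc (length (replicate L flood) + suc (length (replicate S prune ++ conclude ∷ [])))
        ≡⟨ cong₂ (λ i j → suc (i + suc j)) (List.length-replicate L)
             (trans (List.length-++ (replicate S prune)) (cong (_+ 1) (List.length-replicate S))) ⟩
      suc (L + suc (S + 1))
        ≡⟨ reorder L S ⟩
      L + S + 3 ∎

  receiveState : ∀ {d} → List Phase × Local d → (Fin d → Bits (factor * ℓ)) → List Phase × Local d
  receiveState ([]     , x) m = [] , x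
  receiveState (ϕ ∷ ϕs , x) m = ϕs , update ϕ x (decode ∘ m)

  -- The list of phases still to run serves as a clock; it is the same at all nodes, which therefore
  -- stay in step.
  tester : Algorithm (a * ℓ) (factor * ℓ)
  tester = record
    { rounds     = length (repeated T)
    ; randomBits = T * B
    ; State      = λ d → List Phase × Local d
    ; init       = λ d i seed → repeated T , initial i (Vec.toList (chunk T seed))
    ; send       = λ d s p → encode (outgoing (proj₂ s) p)
    ; receive    = λ d → receiveState
    ; accepts    = λ d s → not (rejected (proj₂ s))
    }

  module _ {G : Graph n} (N : Network G (a * ℓ)) where

    open Network N hiding (ident)
    open Execution tester N
    open Global N
    open Step

    configAt : ℕ → Seeds → Config
    configAt t ω x = proj₂ (stateAfter t ω x)

    receiveState-∷ : ∀ {d ϕ ϕs} (s : List Phase × Local d) m → proj₁ s ≡ ϕ ∷ ϕs →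
                     proj₁ (receiveState s m) ≡ ϕs × proj₂ (receiveState s m) ≡ update ϕ (proj₂ s) (decode ∘ m)
    receiveState-∷ (_ ∷ _ , x) m refl = refl , refl

    runFrom : ∀ ω ϕs t → (∀ x → proj₁ (stateAfter t ω x) ≡ ϕs) →
              Run ϕs (configAt t ω) (configAt (length ϕs + t) ω)
    runFrom ω []       t eq = []
    runFrom ω (ϕ ∷ ϕs) t eq =
      st ∷ subst (λ r → Run ϕs (configAt (suc t) ω) (configAt r ω)) (+-suc (length ϕs) t)
             (runFrom ω ϕs (suc t) λ x → proj₁ (receiveState-∷ (stateAfter t ω x) _ (eq x)))
      where
      st : Step ϕ (configAt t ω) (configAt (suc t) ω)
      -- The existence of a port gives an edge, hence ℓ is positive and decoding inverts encoding.
      stepAt st x = _ , (λ p → decode-encode (0<⌈log₂n⌉ G (nbr-adj x p)) _) ,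
                    proj₂ (receiveState-∷ (stateAfter t ω x) _ (eq x))

    final : Seeds → Config
    final ω = configAt (length (repeated T)) ω

    run : ∀ ω → Run (repeated T) (configAt 0 ω) (final ω)
    run ω = subst (λ r → Run (repeated T) (configAt 0 ω) (configAt r ω)) (+-identityʳ (length (repeated T)))
              (runFrom ω (repeated T) 0 λ _ → refl)

    module _ (within : ∀ i → Within H u L i) (uv : Adj H u v) where

      module _ {ys} (order : EliminationOrder H ys) (covers : ∀ {i} → i ≢ u → i ≢ v → i ∈ ys)
               (S≡ : S ≡ length ys + (L + 1)) where

        accepts-free : Free H G → ∀ ω → AllAccept ω
        accepts-free free ω x = cong not (unrejected T (run ω) (λ _ → refl) (λ _ → refl) x)
          where
          unrejected : ∀ t {c c′} → Run (repeated t) c c′ → Identified c → Unrejected c → Unrejected c′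
          unrejected zero    [] ids un = un
          unrejected (suc t) r  ids un with run-++ (iteration L S) r
          ... | c₁ , r₁ , r₂ = unrejected t r₂ (run-all Identified identified-step (iteration L S) r₁ ids)
                (Sound.sound within order covers uv free
                  (subst (λ s → Run (iteration L s) _ c₁) S≡ r₁) ids un)

      GoodSeeds : Vec (Bits B) n → Set
      GoodSeeds α = Σ[ f ∈ (Fin h → Fin n) ] Σ[ f-adj ∈ (∀ i j → Adj H i j → Adj G (f i) (f j)) ]
                      ∃[ w ] Complete.GoodDraw within uv f f-adj w (lookup α)

      -- The first block on which `s` is positive makes its iteration reject, and rejections are
      -- never withdrawn. If there is no such block, every factor of `failsAll` is 1.
      rejects-good : (s : Vec (Bits B) n → ℕ) → (∀ α → 0 < s α → GoodSeeds α) →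
                     ∀ ω → SomeReject ω ⊎ 1 ≤ failsAll s T ω
      rejects-good s good ω with outcome T ω (run ω) (λ _ → refl) (λ _ → refl)
        where
        outcome : ∀ t (ω : Vec (Bits (t * B)) n) {c c′} → Run (repeated t) c c′ → Identified c →
                  (∀ x → blocks (c x) ≡ Vec.toList (chunk t (lookup ω x))) →
                  (∃[ x ] rejected (c′ x) ≡ true) ⊎ 1 ≤ failsAll s t ω
        outcome zero    ω r ids bl = inj₂ ≤-refl
        outcome (suc t) ω r ids bl with run-++ (iteration L S) r | s (Vec.map (take B) ω) in eq
        ... | c₁ , r₁ , r₂ | zero =
          case outcome t (Vec.map (drop B) ω) r₂ (run-all Identified identified-step (iteration L S) r₁ ids)
                 (λ x → trans (run-blocks L S r₁ x (bl x))
                          (cong (Vec.toList ∘ chunk t) (sym (Vec.lookup-map x (drop B) ω)))) of λ where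
            (inj₁ rej) → inj₁ rej
            (inj₂ 1≤f) → inj₂ (≤-trans 1≤f (≤-reflexive (sym (*-identityˡ _))))
        ... | c₁ , r₁ , r₂ | suc _ with good (Vec.map (take B) ω) (subst (0 <_) (sym eq) (s≤s z≤n))
        ... | f , f-adj , w , gd = inj₁ (f u , run-stays-rejected (repeated t) r₂ (f u)
                (Complete.complete within uv f f-adj gd r₁ ids λ x → _ ,
                  trans (bl x) (cong (_∷ Vec.toList (chunk t (drop B (lookup ω x)))) (sym (Vec.lookup-map x (take B) ω)))))
      ... | inj₁ (x , rej) = inj₁ (x , cong not rej)
      ... | inj₂ 1≤f       = inj₂ 1≤f

-- Counting the draws with a given heaviest arc

-- A discrete mean value bound for the power `suc m`.
suc-^-≤ : ∀ j m → suc j ^ suc m ≤ j ^ suc m + suc m * suc j ^ m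
suc-^-≤ j zero    = ≤-reflexive (base j)
  where
  base : ∀ j → suc j * 1 ≡ j * 1 + (1 + 0) * 1
  base = solve-∀
suc-^-≤ j (suc m) = begin
  suc j * suc j ^ suc m                               ≤⟨ *-monoʳ-≤ (suc j) (suc-^-≤ j m) ⟩
  suc j * (j ^ suc m + suc m * suc j ^ m)             ≡⟨ expand j (j ^ suc m) (suc m) (suc j ^ m) ⟩
  j * j ^ suc m + (j ^ suc m + suc m * (suc j * suc j ^ m)) ≤⟨ +-monoʳ-≤ (j * j ^ suc m) (+-monoˡ-≤ _ (^-monoˡ-≤ (suc m) (n≤1+n j))) ⟩
  j * j ^ suc m + suc (suc m) * suc j ^ suc m         ∎
  where
  open ≤-Reasoning
  expand : ∀ j P m Q → suc j * (P + m * Q) ≡ j * P + (P + m * (suc j * Q))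
  expand = solve-∀

-- Among M arcs, a given one is strictly heaviest with weight w in w^(M-1) ways, so this bounds the
-- probability of being strictly heaviest below by 1/(2M). By telescoping the sum is at least
-- (W-1)^M / M, and W ≥ 2M makes (W-1)^M at least half of W^M.
W^M≤2M∑ : ∀ M′ W′ → 2 * suc M′ ≤ suc W′ →
          suc W′ ^ suc M′ ≤ 2 * suc M′ * (∑[ w < W′ ] (suc (toℕ w) ^ M′))
W^M≤2M∑ M′ W′ 2M≤W = +-cancelʳ-≤ (W ^ M) _ _ (begin
  W ^ M + W ^ M                          ≡⟨ cong (W ^ M +_) (+-identityʳ (W ^ M)) ⟨
  2 * W ^ M                              ≤⟨ *-monoʳ-≤ 2 (suc-^-≤ W′ M′) ⟩
  2 * (W′ ^ M + M * W ^ M′)              ≡⟨ expand (W′ ^ M) M (W ^ M′) ⟩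
  2 * W′ ^ M + 2 * M * W ^ M′            ≤⟨ +-mono-≤ (*-monoʳ-≤ 2 powers) (*-monoˡ-≤ (W ^ M′) 2M≤W) ⟩
  2 * (M * ∑^) + W ^ M                   ≡⟨ cong (_+ W ^ M) (*-assoc 2 M ∑^) ⟨
  2 * M * ∑^ + W ^ M                     ∎)
  where
  open ≤-Reasoning
  M = suc M′
  W = suc W′
  ∑^ = ∑[ w < W′ ] (suc (toℕ w) ^ M′)
  expand : ∀ P M Q → 2 * (P + M * Q) ≡ 2 * P + 2 * M * Q
  expand = solve-∀
  powers : W′ ^ M ≤ M * ∑^
  powers = ≤-trans (telescope (_^ M) (λ j → M * suc j ^ M′) (λ j → suc-^-≤ j M′) W′)
                   (≤-reflexive (sym (*-distribˡ-sum {W′} M _)))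

length-allBits : ∀ r → length (allBits r) ≡ 2 ^ r
length-allBits r = length-vectorsOver (false ∷ true ∷ []) r

∑-toNat-≡ : ∀ k {w} → w < 2 ^ k → ∑ₗ (allBits k) (λ y → ⟦ toNat y ℕ.≟ w ⟧) ≡ 1
∑-toNat-≡ k {w} w< = trans (∑-toNat k λ y → ⟦ y ℕ.≟ w ⟧) (sum-equal w<)

∑-toNat-< : ∀ k {w} → w ≤ 2 ^ k → ∑ₗ (allBits k) (λ y → ⟦ toNat y ℕ.<? w ⟧) ≡ w
∑-toNat-< k {w} w≤ = trans (∑-toNat k λ y → ⟦ y ℕ.<? w ⟧) (sum-below w≤)

∏∏ : ∀ {m n} → (Fin m → Fin n → ℕ) → ℕ
∏∏ f = product λ i → product (f i)

∏∏-* : ∀ {m n} (f g : Fin m → Fin n → ℕ) → ∏∏ (λ i j → f i j * g i j) ≡ ∏∏ f * ∏∏ g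
∏∏-* {m} {n} f g = trans (product-cong {m} λ i → product-* (f i) (g i)) (product-* {m} _ _)

∏∏-^ : ∀ {m n} c (f : Fin m → Fin n → ℕ) → ∏∏ (λ i j → c ^ f i j) ≡ c ^ (∑[ i < m ] sum (f i))
∏∏-^ {m} c f = trans (product-cong {m} λ i → product-^ c (f i)) (product-^ c λ i → sum (f i))

∑∑-single : ∀ {n} (f : Fin n → Fin n → ℕ) {x₀ k₀} → f x₀ k₀ ≡ 1 → (∀ x k → f x k ≤ 1) →
            (∀ x k → 0 < f x k → x ≡ x₀ × k ≡ k₀) → (∑[ x < n ] sum (f x)) ≡ 1
∑∑-single {n} f {x₀} {k₀} f≡1 f≤1 only = ≤-antisym
  (sum-unique {n} (λ x → sum (f x))
    (λ x → sum-unique (f x) (f≤1 x) λ k k′ p q → trans (proj₂ (only x k p)) (sym (proj₂ (only x k′ q))))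
    (λ x x′ p q → trans (at x p) (sym (at x′ q))))
  (≤-trans (≤-reflexive (sym f≡1)) (≤-trans (term≤sum (f x₀) k₀) (term≤sum (λ x → sum (f x)) x₀)))
  where
  at : ∀ x → 0 < sum (f x) → x ≡ x₀
  at x p = let k , q = sum-positive (f x) p in proj₁ (only x k q)

module Counting {h : ℕ} (H : Graph h) (u v : Fin h) (n K b : ℕ) {G : Graph n} (N : Network G b) where

  open Protocol H u v n K b
  open Network N hiding (ident)

  Ω : List (Vec (Bits B) n)
  Ω = vectorsOver (allBits B) n

  W : ℕ
  W = 2 ^ K

  deg≤n : ∀ x → deg x ≤ n
  deg≤n x = Fin.injective⇒≤ (nbr-injective x)

  -- Each node draws `n` weights, one per slot, but only the slots below its degree belong to ports.
  -- Hence `M` is the number of arcs.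
  used : Fin n → Fin n → ℕ
  used x k = ⟦ toℕ k ℕ.<? deg x ⟧

  M : ℕ
  M = ∑[ x < n ] ∑[ k < n ] used x k

  M≤n*n : M ≤ n * n
  M≤n*n = ≤-trans (sum-mono-≤ {n} λ x → ≤-trans (sum-mono-≤ {n} λ k → ⟦⟧≤1 (toℕ k ℕ.<? deg x))
                     (≤-reflexive (trans (sum-const n 1) (*-identityʳ n))))
                  (≤-reflexive (sum-const n n))

  M≤2*edgeCount : M ≤ 2 * edgeCount G
  M≤2*edgeCount = ≤-trans
    (sum-mono-≤ {n} λ x → ≤-trans (≤-reflexive (sum-below (deg≤n x)))
       (sum-injection (λ j → adj G x j Bool.≟ true) (nbr x) (nbr-injective x) (nbr-adj x)))
    (arcs≤2*edgeCount G)

  module _ (f : Fin h → Fin n) (f-injective : Injective _≡_ _≡_ f)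
           (f-adj : ∀ i j → Adj H i j → Adj G (f i) (f j)) (uv : Adj H u v) where

    Wanted : Fin n → Bits h → Set
    Wanted x c = ∀ i → f i ≡ x → c ≡ oneHot i

    wanted? : ∀ x → Decidable (Wanted x)
    wanted? x c = Fin.all? λ i → (f i Fin.≟ x) →-dec (c ≟ᵇ oneHot i)

    arc? : ∀ x (p : Fin (deg x)) → Dec (x ≡ f u × nbr x p ≡ f v)
    arc? x p = (x Fin.≟ f u) ×-dec (nbr x p Fin.≟ f v)

    portFits : ℕ → ∀ x → Fin (deg x) → Bits K → ℕ
    portFits w x p y with arc? x p
    ... | yes _ = ⟦ toNat y ℕ.≟ w ⟧
    ... | no _  = ⟦ toNat y ℕ.<? w ⟧

    slotFits : ℕ → Fin n → Fin n → Bits K → ℕ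
    slotFits w x k y with toℕ k ℕ.<? deg x
    ... | yes k< = portFits w x (Fin.fromℕ< k<) y
    ... | no _   = 1

    blockFits : ℕ → Fin n → Bits B → ℕ
    blockFits w x β = ⟦ wanted? x (take h β) ⟧ * product (λ k → slotFits w x k (lookup (chunk n (drop h β)) k))

    -- An indicator of good draws with maximum `w`, written as a product of functions of separate
    -- coordinates so that the count factorises.
    fits : ℕ → Vec (Bits B) n → ℕ
    fits w α = product λ x → blockFits w x (lookup α x)

    slotFits≤1 : ∀ w x k y → slotFits w x k y ≤ 1
    slotFits≤1 w x k y with toℕ k ℕ.<? deg x
    ... | no _   = ≤-refl
    ... | yes k< with arc? x (Fin.fromℕ< k<)
    ... | yes _ = ⟦⟧≤1 (toNat y ℕ.≟ w)
    ... | no _  = ⟦⟧≤1 (toNat y ℕ.<? w)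

    fits≤1 : ∀ w α → fits w α ≤ 1
    fits≤1 w α = product≤1 _ λ x → *-mono-≤ (⟦⟧≤1 (wanted? x (take h (lookup α x))))
                                            (product≤1 _ λ k → slotFits≤1 w x k _)

    slot : ∀ x → Fin (deg x) → Fin n
    slot x p = Fin.inject≤ p (deg≤n x)

    slotFits-slot : ∀ w x p y → slotFits w x (slot x p) y ≡ portFits w x p y
    slotFits-slot w x p y with toℕ (slot x p) ℕ.<? deg x
    ... | yes k< = cong (λ q → portFits w x q y)
                     (Fin.toℕ-injective (trans (Fin.toℕ-fromℕ< k<) (Fin.toℕ-inject≤ p (deg≤n x))))
    ... | no k≮  = contradiction (subst (_< deg x) (sym (Fin.toℕ-inject≤ p (deg≤n x))) (Fin.toℕ<n p)) k≮

    blockWeight-slot : ∀ β x p → blockWeight β (toℕ p) ≡ lookup (chunk n (drop h β)) (slot x p)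
    blockWeight-slot β x p = trans (cong (blockWeight β) (sym (Fin.toℕ-inject≤ p (deg≤n x))))
                                   (weightAt-toℕ (chunk n (drop h β)) (slot x p))

    factors-positive : ∀ {a b} → 0 < a * b → 0 < a × 0 < b
    factors-positive {suc a} {suc b} _ = s≤s z≤n , s≤s z≤n
    factors-positive {suc a} {zero}  p = contradiction (subst (0 <_) (*-zeroʳ a) p) λ ()

    module _ {L : ℕ} (within : ∀ i → Within H u L i) where

      open Global N
      open Complete within uv f f-adj

      fits⇒good : ∀ {w α} → 0 < fits w α → GoodDraw w (lookup α)
      fits⇒good {w} {α} pos = record { coloured = coloured ; selected = selected ; lighter = lighter }
        where
        block-pos : ∀ x → 0 < ⟦ wanted? x (take h (lookup α x)) ⟧ ×
                          0 < product (λ k → slotFits w x k (lookup (chunk n (drop h (lookup α x))) k))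
        block-pos x = factors-positive (product-positive (λ x → blockFits w x (lookup α x)) pos x)
        coloured : ∀ i → blockColour (lookup α (f i)) ≡ oneHot i
        coloured i = ⟦⟧-positive (wanted? (f i) _) (proj₁ (block-pos (f i))) i refl
        port-pos : ∀ x p → 0 < portFits w x p (blockWeight (lookup α x) (toℕ p))
        port-pos x p = subst (0 <_)
          (trans (slotFits-slot w x p _) (cong (portFits w x p) (sym (blockWeight-slot (lookup α x) x p))))
          (product-positive _ (proj₂ (block-pos x)) (slot x p))
        selected : ∀ x p → SelectedArc x p → toNat (blockWeight (lookup α x) (toℕ p)) ≡ w
        selected x p sel with arc? x p | port-pos x p
        ... | yes _ | pp = ⟦⟧-positive (_ ℕ.≟ w) pp
        ... | no ¬s | _  = contradiction sel ¬s
        lighter : ∀ x p → ¬ SelectedArc x p → toNat (blockWeight (lookup α x) (toℕ p)) < w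
        lighter x p ¬sel with arc? x p | port-pos x p
        ... | yes s | _  = contradiction s ¬sel
        ... | no _  | pp = ⟦⟧-positive (_ ℕ.<? w) pp

    -- Colours

    -- Each of the `h` vertices of a copy has one suitable colour among `2 ^ h`, so all roles are
    -- right with probability 1 / `penalty`.
    penalty : ℕ
    penalty = (2 ^ h) ^ h

    private
      colourCount : Fin n → ℕ
      colourCount x = ∑ₗ (allBits h) λ c → ⟦ wanted? x c ⟧

      factor : Fin n → Fin h → ℕ
      factor x i = (2 ^ h) ^ ⟦ f i Fin.≟ x ⟧

    1≤2^h^ : ∀ e → 1 ≤ (2 ^ h) ^ e
    1≤2^h^ e = subst (1 ≤_) (sym (^-*-assoc 2 h e)) (m^n>0 2 (h * e))

    -- A vertex of the copy loses a factor `2 ^ h`, any other vertex nothing. Expressing the loss as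
    -- `product (factor x)` treats both alike, and over all vertices the exponents sum to `h`.
    colourCount-bound : ∀ x → 2 ^ h ≤ colourCount x * product (factor x)
    colourCount-bound x with Fin.any? (λ i → f i Fin.≟ x)
    ... | yes (i , refl) = begin
      2 ^ h                                  ≡⟨ *-identityʳ (2 ^ h) ⟨
      (2 ^ h) ^ 1                            ≡⟨ cong ((2 ^ h) ^_) (⟦⟧-yes (f i Fin.≟ f i) refl) ⟨
      factor (f i) i                         ≤⟨ term≤product (factor (f i)) (λ j → 1≤2^h^ ⟦ f j Fin.≟ f i ⟧) i ⟩
      product (factor (f i))                 ≡⟨ *-identityˡ _ ⟨
      1 * product (factor (f i))             ≤⟨ *-monoˡ-≤ _ one-colour ⟩
      colourCount (f i) * product (factor (f i)) ∎
      where
      open ≤-Reasoning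
      one-colour : 1 ≤ colourCount (f i)
      one-colour = ≤-trans
        (≤-reflexive (sym (⟦⟧-yes (wanted? (f i) (oneHot i)) λ j eq → cong oneHot (sym (f-injective eq)))))
        (∑ₗ-∈ (λ c → ⟦ wanted? (f i) c ⟧) (∈-allBits (oneHot i)))
    ... | no ¬∃ = begin
      2 ^ h                                  ≡⟨ length-allBits h ⟨
      length (allBits h)                     ≡⟨ ∑ₗ-one (allBits h) ⟨
      ∑ₗ (allBits h) (λ _ → 1)               ≡⟨ ∑ₗ-cong (allBits h) (λ c → ⟦⟧-yes (wanted? x c) λ i eq → contradiction (i , eq) ¬∃) ⟨
      colourCount x                          ≡⟨ *-identityʳ _ ⟨
      colourCount x * 1                      ≤⟨ *-monoʳ-≤ (colourCount x) (product-pos (factor x) λ i → 1≤2^h^ ⟦ f i Fin.≟ x ⟧) ⟩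
      colourCount x * product (factor x)     ∎
      where open ≤-Reasoning

    colours-bound : (2 ^ h) ^ n ≤ product colourCount * penalty
    colours-bound = begin
      (2 ^ h) ^ n                                    ≡⟨ product-const n (2 ^ h) ⟨
      product {n} (λ _ → 2 ^ h)                      ≤⟨ product-mono-≤ {n} colourCount-bound ⟩
      product (λ x → colourCount x * product (factor x)) ≡⟨ product-* colourCount (λ x → product (factor x)) ⟩
      product colourCount * ∏∏ factor                ≡⟨ cong (product colourCount *_) factors ⟩
      product colourCount * penalty                  ∎
      where
      open ≤-Reasoning
      factors : ∏∏ factor ≡ penalty
      factors = trans (∏∏-^ (2 ^ h) (λ x i → ⟦ f i Fin.≟ x ⟧))
        (cong ((2 ^ h) ^_) (trans (∑-comm (λ x i → ⟦ f i Fin.≟ x ⟧))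
          (trans (sum-cong-≗ {h} λ i → sum-indicator (f i)) (trans (sum-const h 1) (*-identityʳ h)))))

    -- Weights

    private
      p₀ : Fin (deg (f u))
      p₀ = port (f u) (f v) (f-adj u v uv)

      selected : Fin n → Fin n → ℕ
      selected x k with toℕ k ℕ.<? deg x
      ... | yes k< = ⟦ arc? x (Fin.fromℕ< k<) ⟧
      ... | no _   = 0

      slotCount : ℕ → Fin n → Fin n → ℕ
      slotCount w x k = ∑ₗ (allBits K) (slotFits w x k)

      unused : Fin n → Fin n → ℕ
      unused x k = 1 ∸ used x k

    ∑selected : (∑[ x < n ] sum (selected x)) ≡ 1
    ∑selected = ∑∑-single selected {f u} {slot (f u) p₀} at ≤1 only
      where
      at : selected (f u) (slot (f u) p₀) ≡ 1
      at with toℕ (slot (f u) p₀) ℕ.<? deg (f u)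
      ... | yes k< = ⟦⟧-yes (arc? (f u) (Fin.fromℕ< k<)) (refl , trans (cong (nbr (f u))
                       (Fin.toℕ-injective (trans (Fin.toℕ-fromℕ< k<) (Fin.toℕ-inject≤ p₀ (deg≤n (f u))))))
                       (nbr-port (f u) (f v) (f-adj u v uv)))
      ... | no k≮  = contradiction (subst (_< deg (f u)) (sym (Fin.toℕ-inject≤ p₀ (deg≤n (f u)))) (Fin.toℕ<n p₀)) k≮
      ≤1 : ∀ x k → selected x k ≤ 1
      ≤1 x k with toℕ k ℕ.<? deg x
      ... | yes k< = ⟦⟧≤1 (arc? x (Fin.fromℕ< k<))
      ... | no _   = z≤n
      only : ∀ x k → 0 < selected x k → x ≡ f u × k ≡ slot (f u) p₀
      only x k pos with toℕ k ℕ.<? deg x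
      ... | yes k< with ⟦⟧-positive (arc? x (Fin.fromℕ< k<)) pos
      ... | refl , eq = refl , Fin.toℕ-injective (trans (sym (Fin.toℕ-fromℕ< k<))
              (trans (cong toℕ (nbr-injective (f u) (trans eq (sym (nbr-port (f u) (f v) (f-adj u v uv))))))
                     (sym (Fin.toℕ-inject≤ p₀ (deg≤n (f u))))))

    slotCount-^ : ∀ {w} → w < W → ∀ x k →
                  w ^ selected x k * slotCount w x k ≡ w ^ used x k * W ^ unused x k
    slotCount-^ {w} w<W x k with toℕ k ℕ.<? deg x
    ... | no _ = cong (1 *_) (begin
        ∑ₗ (allBits K) (λ _ → 1)   ≡⟨ ∑ₗ-one (allBits K) ⟩
        length (allBits K)         ≡⟨ length-allBits K ⟩
        W                          ≡⟨ *-identityʳ W ⟨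
        W * 1                      ∎)
      where open ≡-Reasoning
    ... | yes k< with arc? x (Fin.fromℕ< k<)
    ... | yes _ = cong (w ^ 1 *_) (∑-toNat-≡ K w<W)
    ... | no _  = trans (+-identityʳ _) (trans (∑-toNat-< K (<⇒≤ w<W)) (sym (trans (*-identityʳ (w ^ 1)) (*-identityʳ w))))

    U : ℕ
    U = ∑[ x < n ] sum (unused x)

    M+U : M + U ≡ n * n
    M+U = begin
      M + U                                                  ≡⟨ ∑-distrib-+ {n} (λ x → sum (used x)) (λ x → sum (unused x)) ⟨
      (∑[ x < n ] (sum (used x) + sum (unused x)))           ≡⟨ sum-cong-≗ {n} (λ x → sym (∑-distrib-+ (used x) (unused x))) ⟩
      (∑[ x < n ] ∑[ k < n ] (used x k + unused x k))        ≡⟨ sum-cong-≗ {n} (λ x → sum-cong-≗ {n} λ k → m+[n∸m]≡n (⟦⟧≤1 (toℕ k ℕ.<? deg x))) ⟩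
      (∑[ x < n ] ∑[ k < n ] 1)                              ≡⟨ sum-cong-≗ {n} (λ x → trans (sum-const n 1) (*-identityʳ n)) ⟩
      (∑[ x < n ] n)                                         ≡⟨ sum-const n n ⟩
      n * n                                                  ∎
      where open ≡-Reasoning

    selected≤used : ∀ x k → selected x k ≤ used x k
    selected≤used x k with toℕ k ℕ.<? deg x
    ... | yes k< = ⟦⟧≤1 (arc? x (Fin.fromℕ< k<))
    ... | no _   = z≤n

    M-positive : 0 < M
    M-positive = ≤-trans (≤-reflexive (sym ∑selected))
      (sum-mono-≤ {n} λ x → sum-mono-≤ {n} λ k → selected≤used x k)

    slots-count : ∀ {w} → w < W → w * ∏∏ (slotCount w) ≡ w ^ M * W ^ U
    slots-count {w} w<W = begin
      w * ∏∏ (slotCount w)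
        ≡⟨ cong (_* ∏∏ (slotCount w)) (*-identityʳ w) ⟨
      w ^ 1 * ∏∏ (slotCount w)
        ≡⟨ cong (λ e → w ^ e * ∏∏ (slotCount w)) ∑selected ⟨
      w ^ (∑[ x < n ] sum (selected x)) * ∏∏ (slotCount w)
        ≡⟨ cong (_* ∏∏ (slotCount w)) (∏∏-^ w selected) ⟨
      ∏∏ (λ x k → w ^ selected x k) * ∏∏ (slotCount w)
        ≡⟨ ∏∏-* (λ x k → w ^ selected x k) (slotCount w) ⟨
      ∏∏ (λ x k → w ^ selected x k * slotCount w x k)
        ≡⟨ product-cong {n} (λ x → product-cong {n} (slotCount-^ w<W x)) ⟩
      ∏∏ (λ x k → w ^ used x k * W ^ unused x k)
        ≡⟨ ∏∏-* (λ x k → w ^ used x k) (λ x k → W ^ unused x k) ⟩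
      ∏∏ (λ x k → w ^ used x k) * ∏∏ (λ x k → W ^ unused x k)
        ≡⟨ cong₂ _*_ (∏∏-^ w used) (∏∏-^ W unused) ⟩
      w ^ M * W ^ U ∎
      where open ≡-Reasoning

    slots-bound : 2 * M ≤ W → W ^ (n * n) ≤ 2 * M * (∑[ w < W ] ∏∏ (slotCount (toℕ w)))
    slots-bound 2M≤W = bound M W refl refl M-positive
      where
      -- Abstracting `M` and `W` allows matching on successors, which gives names to the
      -- predecessors in `W^M≤2M∑`.
      bound : ∀ M₀ W₀ → M₀ ≡ M → W₀ ≡ W → 0 < M₀ →
              W ^ (n * n) ≤ 2 * M * (∑[ w < W ] ∏∏ (slotCount (toℕ w)))
      bound (suc M′) zero     M≡ W≡ _ = contradiction (subst (2 * M ≤_) (sym W≡) 2M≤W)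
        (<⇒≱ (≤-trans M-positive (m≤m+n M _)))
      bound (suc M′) (suc W′) M≡ W≡ _ = begin
        W ^ (n * n)                                       ≡⟨ cong (W ^_) M+U ⟨
        W ^ (M + U)                                       ≡⟨ ^-distribˡ-+-* W M U ⟩
        W ^ M * W ^ U                                     ≡⟨ cong₂ (λ m w → w ^ m * W ^ U) M≡ W≡ ⟨
        suc W′ ^ suc M′ * W ^ U                           ≤⟨ *-monoˡ-≤ (W ^ U) (W^M≤2M∑ M′ W′ (subst₂ (λ m w → 2 * m ≤ w) (sym M≡) (sym W≡) 2M≤W)) ⟩
        2 * suc M′ * (∑[ w < W′ ] (suc (toℕ w) ^ M′)) * W ^ U ≡⟨ *-assoc (2 * suc M′) (∑[ w < W′ ] (suc (toℕ w) ^ M′)) (W ^ U) ⟩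
        2 * suc M′ * ((∑[ w < W′ ] (suc (toℕ w) ^ M′)) * W ^ U) ≡⟨ cong₂ (λ m s → 2 * m * s) M≡ (*-distribʳ-sum {W′} (W ^ U) _) ⟩
        2 * M * (∑[ w < W′ ] (suc (toℕ w) ^ M′ * W ^ U))  ≡⟨ cong (2 * M *_) (sum-cong-≗ {W′} term) ⟨
        -- The draws with maximum 0 are added back by monotonicity only, because `term` divides by
        -- the weight.
        2 * M * (∑[ w < W′ ] ∏∏ (slotCount (suc (toℕ w)))) ≤⟨ *-monoʳ-≤ (2 * M) (m≤n+m _ (∏∏ (slotCount 0))) ⟩
        2 * M * (∑[ w < suc W′ ] ∏∏ (slotCount (toℕ w)))  ≡⟨ cong (λ V → 2 * M * (∑[ w < V ] ∏∏ (slotCount (toℕ w)))) W≡ ⟩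
        2 * M * (∑[ w < W ] ∏∏ (slotCount (toℕ w)))       ∎
        where
        open ≤-Reasoning
        term : ∀ (w : Fin W′) → ∏∏ (slotCount (suc (toℕ w))) ≡ suc (toℕ w) ^ M′ * W ^ U
        term w = *-cancelˡ-≡ _ _ (suc (toℕ w)) (trans
          (slots-count (subst (suc (toℕ w) <_) W≡ (s≤s (Fin.toℕ<n w))))
          (trans (cong (λ m → suc (toℕ w) ^ m * W ^ U) (sym M≡)) (*-assoc (suc (toℕ w)) (suc (toℕ w) ^ M′) (W ^ U))))

    ∑-fits : ∀ w → ∑ₗ Ω (fits w) ≡ product colourCount * ∏∏ (slotCount w)
    ∑-fits w = begin
      ∑ₗ Ω (fits w)
        ≡⟨ ∑-vectorsOver-product (allBits B) (blockFits w) ⟩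
      product (λ x → ∑ₗ (allBits B) (blockFits w x))
        ≡⟨ product-cong {n} block ⟩
      product (λ x → colourCount x * product (slotCount w x))
        ≡⟨ product-* colourCount (λ x → product (slotCount w x)) ⟩
      product colourCount * ∏∏ (slotCount w) ∎
      where
      open ≡-Reasoning
      block : ∀ x → ∑ₗ (allBits B) (blockFits w x) ≡ colourCount x * product (slotCount w x)
      block x = begin
        ∑ₗ (allBits B) (blockFits w x)
          ≡⟨ ∑-vectorsOver-+ (false ∷ true ∷ []) h (n * K) (λ c ws → wants c * slots (chunk n ws)) ⟩
        ∑ₗ (allBits h) (λ c → ∑ₗ (allBits (n * K)) λ ws → wants c * slots (chunk n ws))
          ≡⟨ ∑ₗ-cong (allBits h) (λ c → ∑ₗ-*ˡ (wants c) (allBits (n * K)) _) ⟩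
        ∑ₗ (allBits h) (λ c → wants c * ∑ₗ (allBits (n * K)) (λ ws → slots (chunk n ws)))
          ≡⟨ ∑ₗ-*ʳ _ (allBits h) wants ⟩
        colourCount x * ∑ₗ (allBits (n * K)) (λ ws → slots (chunk n ws))
          ≡⟨ cong (colourCount x *_) (∑-vectorsOver-chunk (false ∷ true ∷ []) n slots) ⟩
        colourCount x * ∑ₗ (vectorsOver (allBits K) n) slots
          ≡⟨ cong (colourCount x *_) (∑-vectorsOver-product (allBits K) (slotFits w x)) ⟩
        colourCount x * product (slotCount w x) ∎
        where
        wants : Bits h → ℕ
        wants c = ⟦ wanted? x c ⟧
        slots : Vec (Bits K) n → ℕ
        slots ws = product λ k → slotFits w x k (lookup ws k)

    length-Ω≡ : length Ω ≡ (2 ^ h) ^ n * W ^ (n * n)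
    length-Ω≡ = begin
      length Ω                         ≡⟨ length-vectorsOver (allBits B) n ⟩
      length (allBits B) ^ n           ≡⟨ cong (_^ n) (length-allBits B) ⟩
      (2 ^ (h + n * K)) ^ n            ≡⟨ ^-*-assoc 2 (h + n * K) n ⟩
      2 ^ ((h + n * K) * n)            ≡⟨ cong (2 ^_) (reorder h n K) ⟩
      2 ^ (h * n + K * (n * n))        ≡⟨ ^-distribˡ-+-* 2 (h * n) (K * (n * n)) ⟩
      2 ^ (h * n) * 2 ^ (K * (n * n))  ≡⟨ cong₂ _*_ (^-*-assoc 2 h n) (^-*-assoc 2 K (n * n)) ⟨
      (2 ^ h) ^ n * W ^ (n * n)        ∎
      where
      open ≡-Reasoning
      reorder : ∀ h n K → (h + n * K) * n ≡ h * n + K * (n * n)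
      reorder = solve-∀

    often-fits : 2 * M ≤ W → length Ω ≤ 2 * M * penalty * ∑ₗ Ω (λ α → ∑[ w < W ] fits (toℕ w) α)
    often-fits 2M≤W = begin
      length Ω
        ≡⟨ length-Ω≡ ⟩
      (2 ^ h) ^ n * W ^ (n * n)
        ≤⟨ *-mono-≤ colours-bound (slots-bound 2M≤W) ⟩
      product colourCount * penalty * (2 * M * (∑[ w < W ] ∏∏ (slotCount (toℕ w))))
        ≡⟨ reorder (product colourCount) penalty M _ ⟩
      2 * M * penalty * (product colourCount * (∑[ w < W ] ∏∏ (slotCount (toℕ w))))
        ≡⟨ cong (2 * M * penalty *_) (*-distribˡ-sum {W} (product colourCount) _) ⟩
      2 * M * penalty * (∑[ w < W ] (product colourCount * ∏∏ (slotCount (toℕ w))))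
        ≡⟨ cong (2 * M * penalty *_) (sum-cong-≗ {W} λ w → ∑-fits (toℕ w)) ⟨
      2 * M * penalty * (∑[ w < W ] ∑ₗ Ω (fits (toℕ w)))
        ≡⟨ cong (2 * M * penalty *_) (∑ₗ-sum {n = W} Ω (λ α w → fits (toℕ w) α)) ⟨
      2 * M * penalty * ∑ₗ Ω (λ α → ∑[ w < W ] fits (toℕ w) α) ∎
      where
      open ≤-Reasoning
      reorder : ∀ C P M S → C * P * (2 * M * S) ≡ 2 * M * P * (C * S)
      reorder = solve-∀

-- Copies of H through a given arc

module Copies {h n : ℕ} (H : Graph h) (u v : Fin h) (G : Graph n) where

  record CopyAt (i j : Fin n) (f : Fin h → Fin n) : Set where
    field
      injective : ∀ {k l} → f k ≡ f l → k ≡ l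
      preserves : ∀ k l → Adj H k l → Adj G (f k) (f l)
      at-u      : f u ≡ i
      at-v      : f v ≡ j

  open CopyAt

  isCopyAt? : ∀ i j f → Dec (CopyAt i j f)
  isCopyAt? i j f = map′
    (λ (inj , pres , fu , fv) → record { injective = inj _ _ ; preserves = pres ; at-u = fu ; at-v = fv })
    (λ c → (λ _ _ → injective c) , preserves c , at-u c , at-v c)
    ((Fin.all? λ k → Fin.all? λ l → (f k Fin.≟ f l) →-dec (k Fin.≟ l)) ×-dec
     (Fin.all? λ k → Fin.all? λ l → (adj H k l Bool.≟ true) →-dec (adj G (f k) (f l) Bool.≟ true)) ×-dec
     (f u Fin.≟ i) ×-dec (f v Fin.≟ j))

  copyAt-resp : ∀ {i j f g} → (∀ k → f k ≡ g k) → CopyAt i j f → CopyAt i j g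
  copyAt-resp f≗g c = record
    { injective = λ {k} {l} eq → injective c (trans (f≗g k) (trans eq (sym (f≗g l))))
    ; preserves = λ k l kl → subst₂ (Adj G) (f≗g k) (f≗g l) (preserves c k l kl)
    ; at-u      = trans (sym (f≗g u)) (at-u c)
    ; at-v      = trans (sym (f≗g v)) (at-v c)
    }

  -- Maps are enumerated as elements of a finite type and recovered only up to pointwise equality,
  -- hence `copyAt-resp`. Abstractness keeps this exhaustive search from being unfolded.
  abstract
    copy? : ∀ i j → Dec (∃[ f ] CopyAt i j f)
    copy? i j = map′ (λ (k , c) → Fin.finToFun k , c)
      (λ (f , c) → Fin.funToFin f , copyAt-resp (λ k → sym (Fin.finToFun-funToFin f k)) c)
      (Fin.any? λ k → isCopyAt? i j (Fin.finToFun k))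

  copyArcs : ℕ
  copyArcs = ∑[ i < n ] ∑[ j < n ] ⟦ copy? i j ⟧

  private
    onCopy : Fin n → Fin n → Bool
    onCopy i j = does (copy? i j) ∨ does (copy? j i)

  pruned : Graph n
  pruned = record
    { adj    = λ i j → adj G i j ∧ not (onCopy i j)
    ; symm   = λ i j → cong₂ (λ a b → a ∧ not b) (symm G i j) (Bool.∨-comm (does (copy? i j)) _)
    ; irrefl = λ i → cong (_∧ not (onCopy i i)) (irrefl G i)
    }

  -- A copy in `pruned` is also a copy in `G`, so its image of `uv` has been deleted.
  pruned-free : Adj H u v → Free H pruned
  pruned-free uv (f , inj , pres) = case trans (sym (proj₂ (∧-true⁻ (pres u v uv)))) removed of λ ()
    where
    removed : not (onCopy (f u) (f v)) ≡ false
    removed = cong (λ b → not (b ∨ does (copy? (f v) (f u)))) (dec-true (copy? (f u) (f v)) (f , record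
      { injective = inj ; preserves = λ k l kl → proj₁ (∧-true⁻ (pres k l kl)) ; at-u = refl ; at-v = refl }))

  -- Each deleted edge is charged to one of its two arcs that is the image of (u , v) in a copy.
  editDistance-pruned : editDistance G pruned ≤ copyArcs
  editDistance-pruned = begin
    editDistance G pruned
      ≡⟨ length-filter≡∑ₗ (λ (i , j) → ¬? (adj G i j Bool.≟ adj pruned i j)) (vertexPairs n) ⟩
    ∑ₗ (vertexPairs n) (λ (i , j) → ⟦ ¬? (adj G i j Bool.≟ adj pruned i j) ⟧)
      ≤⟨ ∑ₗ-mono-≤ (vertexPairs n) (λ (i , j) → pointwise i j) ⟩
    ∑ₗ (vertexPairs n) (λ (i , j) → ⟦ copy? i j ⟧ + ⟦ copy? j i ⟧)
      ≤⟨ ∑-vertexPairs≤ (λ i j → ⟦ copy? i j ⟧) ⟩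
    copyArcs ∎
    where
    open ≤-Reasoning
    pointwise : ∀ i j → ⟦ ¬? (adj G i j Bool.≟ adj pruned i j) ⟧ ≤ ⟦ copy? i j ⟧ + ⟦ copy? j i ⟧
    pointwise i j with copy? i j | copy? j i
    ... | yes _ | d     = ≤-trans (⟦⟧≤1 (¬? (adj G i j Bool.≟ _))) (m≤m+n 1 ⟦ d ⟧)
    ... | no _  | yes _ = ⟦⟧≤1 (¬? (adj G i j Bool.≟ _))
    ... | no _  | no _  = ≤-reflexive (⟦⟧-no (¬? (adj G i j Bool.≟ _)) λ ¬eq → ¬eq (sym (Bool.∧-identityʳ _)))

-- The success probability of one iteration

module Success {h : ℕ} (H : Graph h) (u v : Fin h) (uv : Adj H u v) (n K b : ℕ) {G : Graph n} (N : Network G b)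
               {L : ℕ} (within : ∀ i → Within H u L i) where

  open Protocol H u v n K b
  open Network N hiding (ident)
  open Global N
  open Counting H u v n K b N
  open Copies H u v G
  open CopyAt

  GoodFor : ∀ {f i j} → CopyAt i j f → ℕ → Vec (Bits B) n → Set
  GoodFor {f} c w α = Complete.GoodDraw within uv f (preserves c) w (lookup α)

  -- If the two arcs differed, the arc of the first copy would be strictly lighter than `w′`,
  -- contrary to `¬ (w < w′)`. So the arcs agree, and the draw gives them a single weight.
  good-agree : ∀ {f g i j i′ j′ w w′ α} (c : CopyAt i j f) (c′ : CopyAt i′ j′ g) →
               GoodFor c w α → GoodFor c′ w′ α → ¬ (w < w′) → f u ≡ g u × f v ≡ g v × w ≡ w′
  good-agree {f} {g} {w′ = w′} {α} c c′ good good′ w≮w′ = agree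
    where
    p : Fin (deg (f u))
    p = port (f u) (f v) (preserves c u v uv)
    p≡ : nbr (f u) p ≡ f v
    p≡ = nbr-port (f u) (f v) (preserves c u v uv)
    w≡ = Complete.GoodDraw.selected good (f u) p (refl , p≡)
    agree : _
    agree with f u Fin.≟ g u | nbr (f u) p Fin.≟ g v
    ... | yes eq | yes eq′ = eq , trans (sym p≡) eq′ ,
            trans (sym w≡) (Complete.GoodDraw.selected good′ (f u) p (eq , eq′))
    ... | no ¬eq | _ = contradiction
            (subst (_< w′) w≡ (Complete.GoodDraw.lighter good′ (f u) p (¬eq ∘ proj₁))) w≮w′
    ... | yes _ | no ¬eq = contradiction
            (subst (_< w′) w≡ (Complete.GoodDraw.lighter good′ (f u) p (¬eq ∘ proj₂))) w≮w′

  good-unique : ∀ {f g i j i′ j′ w w′ α} (c : CopyAt i j f) (c′ : CopyAt i′ j′ g) →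
                GoodFor c w α → GoodFor c′ w′ α → i ≡ i′ × j ≡ j′ × w ≡ w′
  good-unique {w = w} {w′} {α} c c′ good good′ with w ℕ.<? w′
  ... | no w≮w′ = let a , b , e = good-agree {α = α} c c′ good good′ w≮w′
                  in trans (sym (at-u c)) (trans a (at-u c′)) , trans (sym (at-v c)) (trans b (at-v c′)) , e
  ... | yes w<w′ = let a , b , e = good-agree {α = α} c′ c good′ good (<-asym w<w′)
                   in trans (sym (at-u c)) (trans (sym a) (at-u c′)) ,
                      trans (sym (at-v c)) (trans (sym b) (at-v c′)) , sym e

  -- Only the copy supplied by `copy?` is considered for an arc: one draw can fit several copies
  -- through the same arc and would then be counted repeatedly.
  successAt : ∀ i j → Dec (∃[ f ] CopyAt i j f) → Vec (Bits B) n → ℕ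
  successAt i j (yes (f , c)) α = ∑[ w < W ] fits f (injective c) (preserves c) uv (toℕ w) α
  successAt i j (no _)        α = 0

  success : Vec (Bits B) n → ℕ
  success α = ∑[ i < n ] ∑[ j < n ] successAt i j (copy? i j) α

  successAt-good : ∀ i j d α → 0 < successAt i j d α → ∃[ f ] Σ[ c ∈ CopyAt i j f ] ∃[ w ] GoodFor c w α
  successAt-good i j (yes (f , c)) α pos =
    let w , pos′ = sum-positive {W} (λ w → fits f (injective c) (preserves c) uv (toℕ w) α) pos
    in f , c , toℕ w , fits⇒good f (injective c) (preserves c) uv within {α = α} pos′

  success-good : ∀ α → 0 < success α →
                 ∃[ f ] Σ[ f-adj ∈ (∀ k l → Adj H k l → Adj G (f k) (f l)) ]
                 ∃[ w ] Complete.GoodDraw within uv f f-adj w (lookup α)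
  success-good α pos =
    let i , posᵢ = sum-positive {n} (λ i → ∑[ j < n ] successAt i j (copy? i j) α) pos
        j , posⱼ = sum-positive {n} (λ j → successAt i j (copy? i j) α) posᵢ
        f , c , good = successAt-good i j (copy? i j) α posⱼ
    in f , preserves c , good

  -- Uniqueness of the strictly heaviest arc makes the events for different arcs and weights
  -- disjoint, so the sum of their indicators is an indicator again.
  success≤1 : ∀ α → success α ≤ 1
  success≤1 α = sum-unique {n} _
    (λ i → sum-unique {n} _ (λ j → at≤1 i j (copy? i j))
      λ j j′ p q → let _ , c , _ , good = successAt-good i j (copy? i j) α p
                       _ , c′ , _ , good′ = successAt-good i j′ (copy? i j′) α q
                   in proj₁ (proj₂ (good-unique {α = α} c c′ good good′)))
    λ i i′ p q → let j , pⱼ = sum-positive {n} (λ j → successAt i j (copy? i j) α) p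
                     j′ , qⱼ = sum-positive {n} (λ j → successAt i′ j (copy? i′ j) α) q
                     _ , c , _ , good = successAt-good i j (copy? i j) α pⱼ
                     _ , c′ , _ , good′ = successAt-good i′ j′ (copy? i′ j′) α qⱼ
                 in proj₁ (good-unique {α = α} c c′ good good′)
    where
    at≤1 : ∀ i j d → successAt i j d α ≤ 1
    at≤1 i j (no _) = z≤n
    at≤1 i j (yes (f , c)) = sum-unique {W} _
      (λ w → fits≤1 f (injective c) (preserves c) uv (toℕ w) α)
      λ w w′ p q → Fin.toℕ-injective (proj₂ (proj₂ (good-unique {α = α} c c
        (fits⇒good f (injective c) (preserves c) uv within {α = α} p)
        (fits⇒good f (injective c) (preserves c) uv within {α = α} q))))

  -- Each copy arc contributes at least a fraction 1 / (2M · 2^(h²)) of all draws, and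
  -- `M ≤ 2 * edgeCount G` explains the factor 4.
  copyArcs-bound : 2 * M ≤ W → copyArcs * length Ω ≤ 4 * (2 ^ h) ^ h * edgeCount G * ∑ₗ Ω success
  copyArcs-bound 2M≤W = begin
    copyArcs * length Ω
      ≡⟨ *-distribʳ-sum {n} (length Ω) (λ i → ∑[ j < n ] ⟦ copy? i j ⟧) ⟩
    (∑[ i < n ] ((∑[ j < n ] ⟦ copy? i j ⟧) * length Ω))
      ≡⟨ sum-cong-≗ {n} (λ i → *-distribʳ-sum {n} (length Ω) (λ j → ⟦ copy? i j ⟧)) ⟩
    (∑[ i < n ] ∑[ j < n ] (⟦ copy? i j ⟧ * length Ω))
      ≤⟨ sum-mono-≤ {n} (λ i → sum-mono-≤ {n} λ j → arc i j (copy? i j)) ⟩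
    (∑[ i < n ] ∑[ j < n ] (D * ∑ₗ Ω (successAt i j (copy? i j))))
      ≡⟨ sum-cong-≗ {n} (λ i → *-distribˡ-sum {n} D (λ j → ∑ₗ Ω (successAt i j (copy? i j)))) ⟨
    (∑[ i < n ] (D * (∑[ j < n ] ∑ₗ Ω (successAt i j (copy? i j)))))
      ≡⟨ *-distribˡ-sum {n} D (λ i → ∑[ j < n ] ∑ₗ Ω (successAt i j (copy? i j))) ⟨
    D * (∑[ i < n ] ∑[ j < n ] ∑ₗ Ω (successAt i j (copy? i j)))
      ≡⟨ cong (D *_) (sum-cong-≗ {n} λ i → ∑ₗ-sum {n = n} Ω (λ α j → successAt i j (copy? i j) α)) ⟨
    D * (∑[ i < n ] ∑ₗ Ω (λ α → ∑[ j < n ] successAt i j (copy? i j) α))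
      ≡⟨ cong (D *_) (∑ₗ-sum {n = n} Ω (λ α i → ∑[ j < n ] successAt i j (copy? i j) α)) ⟨
    D * ∑ₗ Ω success
      ≤⟨ *-monoˡ-≤ (∑ₗ Ω success) (*-monoˡ-≤ ((2 ^ h) ^ h) (*-monoʳ-≤ 2 M≤2*edgeCount)) ⟩
    2 * (2 * edgeCount G) * (2 ^ h) ^ h * ∑ₗ Ω success
      ≡⟨ reorder (edgeCount G) ((2 ^ h) ^ h) (∑ₗ Ω success) ⟩
    4 * (2 ^ h) ^ h * edgeCount G * ∑ₗ Ω success ∎
    where
    open ≤-Reasoning
    D : ℕ
    D = 2 * M * (2 ^ h) ^ h
    reorder : ∀ m p s → 2 * (2 * m) * p * s ≡ 4 * p * m * s
    reorder = solve-∀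
    arc : ∀ i j d → ⟦ d ⟧ * length Ω ≤ D * ∑ₗ Ω (successAt i j d)
    arc i j (no _)        = z≤n
    arc i j (yes (f , c)) = ≤-trans (≤-reflexive (+-identityʳ (length Ω)))
                                    (often-fits f (injective c) (preserves c) uv 2M≤W)

-- Rational arithmetic

open import Data.Integer using (+_; -[1+_])

fromℕ*≤fromℕ : ∀ r C p d .(c : Coprime p (suc d)) → r * p ≤ C * suc d → fromℕ r ℚ.* mkℚ (+ p) d c ℚ.≤ fromℕ C
fromℕ*≤fromℕ r C p d c le = ℚ.toℚᵘ-cancel-≤ (begin
  ℚ.toℚᵘ (fromℕ r ℚ.* ε)                  ≃⟨ ℚ.toℚᵘ-homo-* (fromℕ r) ε ⟩
  ℚ.toℚᵘ (fromℕ r) ℚᵘ.* ℚ.toℚᵘ ε          ≃⟨ ℚᵘ.*-congʳ {ℚ.toℚᵘ ε} (ℚ.toℚᵘ-fromℚᵘ (ℚᵘ.mkℚᵘ (+ r) 0)) ⟩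
  ℚᵘ.mkℚᵘ (+ r) 0 ℚᵘ.* ℚᵘ.mkℚᵘ (+ p) d    ≤⟨ ℚᵘ.*≤* integers ⟩
  ℚᵘ.mkℚᵘ (+ C) 0                         ≃⟨ ℚ.toℚᵘ-fromℚᵘ (ℚᵘ.mkℚᵘ (+ C) 0) ⟨
  ℚ.toℚᵘ (fromℕ C)                        ∎)
  where
  open ℚᵘ.≤-Reasoning
  ε = mkℚ (+ p) d c
  integers : + r ℤ.* + p ℤ.* + 1 ℤ.≤ + C ℤ.* + suc (d + 0)
  integers = subst₂ ℤ._≤_
    (trans (ℤ.pos-* r p) (sym (ℤ.*-identityʳ _)))
    (trans (ℤ.pos-* C (suc d)) (cong (λ k → + C ℤ.* + suc k) (sym (+-identityʳ d))))
    (ℤ.+≤+ le)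

*fromℕ≤fromℕ⁻ : ∀ m k p d .(c : Coprime p (suc d)) → mkℚ (+ p) d c ℚ.* fromℕ m ℚ.≤ fromℕ k → p * m ≤ k * suc d
*fromℕ≤fromℕ⁻ m k p d c le = ℤ.drop‿+≤+ (subst₂ ℤ._≤_
    (trans (ℤ.*-identityʳ _) (sym (ℤ.pos-* p m)))
    (trans (cong (λ e → + k ℤ.* + suc e) (*-identityʳ d)) (sym (ℤ.pos-* k (suc d))))
    (ℚᵘ.drop-*≤* (begin
      ℚᵘ.mkℚᵘ (+ p) d ℚᵘ.* ℚᵘ.mkℚᵘ (+ m) 0    ≃⟨ ℚᵘ.*-congˡ {ℚ.toℚᵘ ε} (ℚ.toℚᵘ-fromℚᵘ (ℚᵘ.mkℚᵘ (+ m) 0)) ⟨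
      ℚ.toℚᵘ ε ℚᵘ.* ℚ.toℚᵘ (fromℕ m)          ≃⟨ ℚ.toℚᵘ-homo-* ε (fromℕ m) ⟨
      ℚ.toℚᵘ (ε ℚ.* fromℕ m)                  ≤⟨ ℚ.toℚᵘ-mono-≤ le ⟩
      ℚ.toℚᵘ (fromℕ k)                        ≃⟨ ℚ.toℚᵘ-fromℚᵘ (ℚᵘ.mkℚᵘ (+ k) 0) ⟩
      ℚᵘ.mkℚᵘ (+ k) 0                         ∎)))
  where
  open ℚᵘ.≤-Reasoning
  ε = mkℚ (+ p) d c

-- Choosing the number of repetitions

quotient-≤ : ∀ m d → m ≤ suc (m / suc d) * suc d
quotient-≤ m d = begin
  m                                   ≡⟨ m≡m%n+[m/n]*n m (suc d) ⟩
  m % suc d + m / suc d * suc d       ≤⟨ +-monoˡ-≤ _ (<⇒≤ (m%n<n m (suc d))) ⟩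
  suc d + m / suc d * suc d           ∎
  where open ≤-Reasoning

quotient-≥ : ∀ m d → suc (m / suc d) * suc d ≤ m + suc d
quotient-≥ m d = begin
  suc d + m / suc d * suc d                   ≡⟨ +-comm (suc d) _ ⟩
  m / suc d * suc d + suc d                   ≤⟨ +-monoˡ-≤ (suc d) (m≤n+m _ (m % suc d)) ⟩
  m % suc d + m / suc d * suc d + suc d       ≡⟨ cong (_+ suc d) (m≡m%n+[m/n]*n m (suc d)) ⟨
  m + suc d                                   ∎
  where open ≤-Reasoning

-- For 0 < ε this is ⌊Q / ε⌋ + 1.
repetitions : ℕ → ℚ → ℕ
repetitions Q ε = suc ((Q * ↧ₙ ε) / suc (ℕ.pred ℤ.∣ ↥ ε ∣))

-- This is why weights have `3 * ℓ` bits: two thirds of the bits cover the at most n² arcs, the last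
-- third the factor 2 in 2M ≤ W.
2n²≤2^3ℓ : ∀ n → 0 < ⌈log₂ n ⌉ → 2 * (n * n) ≤ 2 ^ (3 * ⌈log₂ n ⌉)
2n²≤2^3ℓ n 0<ℓ = begin
  2 * (n * n)                              ≤⟨ *-mono-≤ (^-monoʳ-≤ 2 0<ℓ) (*-mono-≤ (n≤2^⌈log₂n⌉ n) (n≤2^⌈log₂n⌉ n)) ⟩
  2 ^ ℓ * (2 ^ ℓ * 2 ^ ℓ)                  ≡⟨ cong (λ e → 2 ^ ℓ * (2 ^ ℓ * e)) (*-identityʳ (2 ^ ℓ)) ⟨
  (2 ^ ℓ) ^ 3                              ≡⟨ ^-*-assoc 2 ℓ 3 ⟩
  2 ^ (ℓ * 3)                              ≡⟨ cong (2 ^_) (*-comm ℓ 3) ⟩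
  2 ^ (3 * ℓ)                              ∎
  where
  open ≤-Reasoning
  ℓ = ⌈log₂ n ⌉

edge-exists : ∀ {n} (G : Graph n) → 0 < edgeCount G → ∃[ x ] ∃[ y ] Adj G x y
edge-exists {n} G pos with filter (λ (i , j) → adj G i j Bool.≟ true) (vertexPairs n) in eq
... | (x , y) ∷ _ = x , y , proj₂ (∈-filter⁻ (λ (i , j) → adj G i j Bool.≟ true) {xs = vertexPairs n}
                                    (subst ((x , y) ∈_) (sym eq) (here refl)))

-- Round bound and error probabilities of the tester

module _ {h : ℕ} (H : Graph h) (connected : Connected H) {u v : Fin h}
         (uv : Adj H u v) (meets : EveryCycleMeets H u v) where

  private
    L : ℕ
    L = proj₁ (radius H connected u)

    within : ∀ i → Within H u L i
    within = proj₂ (radius H connected u)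

    ys : List (Fin h)
    ys = proj₁ (eliminationOrder H meets)

    S R Q : ℕ
    S = length ys + (L + 1)
    R = L + S + 3
    Q = 4 * (2 ^ h) ^ h

    algorithm : ∀ a n → ℚ → Algorithm (a * ⌈log₂ n ⌉) ((3 + (a + (h + 2))) * ⌈log₂ n ⌉)
    algorithm a n ε = Tester.tester H u v a n L S (2 * repetitions Q ε)

  -- There are 2kR rounds with k ≤ Q / ε + 1. After multiplication by ε, the additional 1 costs at
  -- most ε ≤ 1, which turns `Q` into `suc Q`.
  rounds-bound : ∀ a n ε → 0ℚ ℚ.< ε → ε ℚ.≤ 1ℚ →
                 fromℕ (Algorithm.rounds (algorithm a n ε)) ℚ.* ε ℚ.≤ fromℕ (2 * R * suc Q)
  rounds-bound a n (mkℚ (+ zero) d c)  (ℚ.*<* (ℤ.+<+ ())) ε≤1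
  rounds-bound a n (mkℚ -[1+ _ ] d c)  (ℚ.*<* ()) ε≤1
  rounds-bound a n ε@(mkℚ (+ suc p) d c) 0<ε (ℚ.*≤* ε≤1) = fromℕ*≤fromℕ r (2 * R * suc Q) (suc p) d c (begin
    r * suc p
      ≡⟨ cong (_* suc p) (Tester.length-repeated H u v a n L S (2 * k) (2 * k)) ⟩
    2 * k * R * suc p                ≡⟨ reorder k R (suc p) ⟩
    2 * R * (k * suc p)              ≤⟨ *-monoʳ-≤ (2 * R) (quotient-≥ (Q * suc d) p) ⟩
    2 * R * (Q * suc d + suc p)      ≤⟨ *-monoʳ-≤ (2 * R) (+-monoʳ-≤ (Q * suc d) p≤d) ⟩
    2 * R * (Q * suc d + suc d)      ≡⟨ collect R Q (suc d) ⟩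
    2 * R * suc Q * suc d            ∎)
    where
    open ≤-Reasoning
    k = repetitions Q ε
    r = Algorithm.rounds (algorithm a n ε)
    reorder : ∀ k R p → 2 * k * R * p ≡ 2 * R * (k * p)
    reorder = solve-∀
    collect : ∀ R Q d → 2 * R * (Q * d + d) ≡ 2 * R * suc Q * d
    collect = solve-∀
    p≤d : suc p ≤ suc d
    p≤d = ℤ.drop‿+≤+ (subst₂ ℤ._≤_ (ℤ.*-identityʳ (+ suc p)) (ℤ.*-identityˡ (+ suc d)) ε≤1)

  module _ (a n : ℕ) {G : Graph n} (N : Network G (a * ⌈log₂ n ⌉)) where

    open Success H u v uv n (3 * ⌈log₂ n ⌉) (a * ⌈log₂ n ⌉) N within
    open Counting H u v n (3 * ⌈log₂ n ⌉) (a * ⌈log₂ n ⌉) N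
    open Copies H u v G

    -- Comparison with `pruned` shows that a far graph has at least ε · |E| copy arcs. One iteration
    -- thus succeeds with probability at least ε / Q, and `repetitions Q ε` exceeds Q / ε. All of
    -- this is multiplied out to natural numbers.
    success-often : ∀ ε → 0ℚ ℚ.< ε → 0 < edgeCount G → IsFar ε (Free H) G →
                    length Ω ≤ repetitions Q ε * ∑ₗ Ω success
    success-often (mkℚ (+ zero) d c)  (ℚ.*<* (ℤ.+<+ ()))
    success-often (mkℚ -[1+ _ ] d c)  (ℚ.*<* ())
    success-often ε@(mkℚ (+ suc p) d c) 0<ε 0<m far = cancel (begin
      suc p * m * length Ω                    ≤⟨ *-monoˡ-≤ (length Ω) arcs ⟩
      copyArcs * suc d * length Ω             ≡⟨ swap copyArcs (suc d) (length Ω) ⟩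
      copyArcs * length Ω * suc d             ≤⟨ *-monoˡ-≤ (suc d) (copyArcs-bound 2M≤W) ⟩
      Q * m * ∑s * suc d                      ≡⟨ gather Q m ∑s (suc d) ⟩
      Q * suc d * (m * ∑s)                    ≤⟨ *-monoˡ-≤ (m * ∑s) (quotient-≤ (Q * suc d) p) ⟩
      k * suc p * (m * ∑s)                    ≡⟨ spread k (suc p) m ∑s ⟩
      suc p * m * (k * ∑s)                    ∎)
      where
      open ≤-Reasoning
      m = edgeCount G
      k = repetitions Q ε
      ∑s = ∑ₗ Ω success
      swap : ∀ x y z → x * y * z ≡ x * z * y
      swap = solve-∀
      gather : ∀ Q m s d → Q * m * s * d ≡ Q * d * (m * s)
      gather = solve-∀
      spread : ∀ k p m s → k * p * (m * s) ≡ p * m * (k * s)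
      spread = solve-∀
      arcs : suc p * m ≤ copyArcs * suc d
      arcs = ≤-trans (*fromℕ≤fromℕ⁻ m (editDistance G pruned) (suc p) d c (far pruned (pruned-free uv)))
                     (*-monoˡ-≤ (suc d) editDistance-pruned)
      2M≤W : 2 * M ≤ W
      2M≤W = let x , y , xy = edge-exists G 0<m
             in ≤-trans (*-monoʳ-≤ 2 M≤n*n) (2n²≤2^3ℓ n (0<⌈log₂n⌉ G xy))
      cancel : suc p * m * length Ω ≤ suc p * m * (k * ∑s) → length Ω ≤ k * ∑s
      cancel = *-cancelˡ-≤ (suc p * m) {{ℕ.>-nonZero (*-mono-≤ {1} {suc p} {1} {m} (s≤s z≤n) 0<m)}}

  testable : FreenessTestableInO[1/ε] H
  testable = 2 * R * suc Q , λ a → 3 + (a + (h + 2)) , algorithm a , λ n ε 0<ε ε≤1 →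
    rounds-bound a n ε 0<ε ε≤1 , λ G N → accepting a n ε N , rejecting a n ε 0<ε N
    where
    accepting : ∀ a n ε {G : Graph n} (N : Network G (a * ⌈log₂ n ⌉)) → Free H G →
                ProbAtLeast⅔ (Execution.AllAccept? (algorithm a n ε) N)
    -- The error is one-sided: every seed accepts, so 2 ≤ 3 is all that remains.
    accepting a n ε N free = ≤-trans (*-monoˡ-≤ (length Ω) (s≤s (s≤s (z≤n {1}))))
      (≤-reflexive (cong (λ xs → 3 * length xs) (sym (List.filter-all (AllAccept? ) (All.universal accepts Ω)))))
      where
      open Execution (algorithm a n ε) N
      Ω = vectorsOver (allBits (Algorithm.randomBits (algorithm a n ε))) n
      accepts : ∀ ω → AllAccept ω
      accepts = Tester.accepts-free H u v a n L S (2 * repetitions Q ε) N within uv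
                  (proj₁ (proj₂ (eliminationOrder H meets))) (λ {i} → proj₁ (proj₂ (proj₂ (eliminationOrder H meets))) {i})
                  refl free
    rejecting : ∀ a n ε → 0ℚ ℚ.< ε → ∀ {G : Graph n} (N : Network G (a * ⌈log₂ n ⌉)) →
                0 < edgeCount G → IsFar ε (Free H) G →
                ProbAtLeast⅔ (Execution.SomeReject? (algorithm a n ε) N)
    rejecting a n ε 0<ε {G} N 0<m far =
      amplify success (repetitions Q ε) SomeReject? success≤1
        (success-often a n N ε 0<ε 0<m far)
        (Tester.rejects-good H u v a n L S (2 * repetitions Q ε) N within uv success success-good)
      where
      open Execution (algorithm a n ε) N
      open Success H u v uv n (3 * ⌈log₂ n ⌉) (a * ⌈log₂ n ⌉) N within

mainTheorem3 : ∀ {h : ℕ} (H : Graph h) → Connected H →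
    (∃[ u ] ∃[ v ] (Adj H u v × EveryCycleMeets H u v)) →
    FreenessTestableInO[1/ε] H
mainTheorem3 H connected (u , v , uv , meets) = testable H connected uv meets
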